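{- For every family $(\alpha_k)$ as below, $\mathrm{3SAT}^{\mathrm C}\notin \mathrm{P}^*_{\mathrm{lis}}$ if and only if $\mathrm{3SAT}\notin\mathrm{P/poly}$.
   Context: $\mathbb B=\{T,F\}$. $\mathrm{3SAT}$ is the language of (standardly encoded) satisfiable 3CNF formulas; $\mathrm{P/poly}$ is the usual class of languages decided by polynomial-size circuit families. Let $v_1,v_2,\dots$ be propositional variables. For $k\in\mathbb N$ let $d(k)=\binom{2k}{1}+\binom{2k}{2}+\binom{2k}{3}$, and let $L_k$ be the set of sets $L$ of literals from $\{v_1,\neg v_1,\dots,v_k,\neg v_k\}$ with $1\le |L|\le 3$. Let $(\alpha_k)_{k\in\mathbb N}$ be bijections $\alpha_k:[1,d(k)]\to L_k$ such that (i) for all $i$ and $j\in[1,d(i)]$, $\alpha_{i+1}(j)=\alpha_i(j)$; and (ii) the map $\alpha(i)=\alpha_k(i)$ for the least $k$ with $i\le d(k)$ is polynomial-time computable. For $n\in\mathbb N$ let $k$ be such that $d(k)\le n<d(k+1)$ and define $\mathrm{3SAT}^{\mathrm C}_n:\mathbb B^n\to\mathbb B$ by $\mathrm{3SAT}^{\mathrm C}_n(b_1,\dots,b_n)=T$ iff $\bigwedge_{i\in[1,d(k)],\,b_i=T}\bigvee\alpha_k(i)$ is satisfiable; $\mathrm{3SAT}^{\mathrm C}=(\mathrm{3SAT}^{\mathrm C}_n)_n$. A primitive instruction is one of: a plain basic instruction $a$, a positive test instruction $+a$, a negative test instruction $-a$ (for a basic instruction $a$), a forward jump instruction $\#l$ ($l\in\mathbb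 N$), or the termination instruction $!$. An instruction sequence is a finite nonempty sequence $X=u_1;\dots;u_k$ of primitive instructions; its length is $|X|=k$. Basic instructions have the form $f.m$ where the focus $f$ is one of $\mathrm{in}{:}i$, $\mathrm{aux}{:}i$ ($i\ge 1$) or $\mathrm{out}$, each naming a Boolean register, and the method $m$ is one of $\mathrm{set}{:}T$, $\mathrm{set}{:}F$, $\mathrm{get}$. Executing $f.\mathrm{set}{:}b$ sets register $f$ to $b$ and yields reply $b$; executing $f.\mathrm{get}$ leaves the register unchanged and yields its content as reply. Execution of $X=u_1;\dots;u_k$: a counter starts at $1$. If the counter exceeds $k$, execution deadlocks. At position $i$: if $u_i=!$, execution terminates; if $u_i=\#l$, execution deadlocks if $l=0$ and otherwise the counter becomes $i+l$; if $u_i$ is $a$, $+a$ or $-a$, the basic instruction $a$ is executed yielding reply $r$, and the counter becomes $i+1$ for $u_i=a$; for $u_i=+a$ it becomes $i+1$ if $r=T$ and $i+2$ if $r=F$; for $u_i=-a$ it becomes $i+1$ if $r=F$ and $i+2$ if $r=T$. $\mathrm{IS}_{br}$ is the set of instruction sequences in which every basic instruction occurring belongs to $\{f.\mathrm{get}: f=\mathrm{in}{:}i \text{ or } f=\mathrm{aux}{:}i\}\cup\{f.\mathrm{set}{:}b: f=\mathrm{aux}{:}i \text{ or } f=\mathrm{out},\ b\in\mathbb B\}$. $X\in\mathrm{IS}_{br}$ computes $f:\mathbb B^n\to\mathbb B$ if for every $(b_1,\dots,b_n)\in\mathbb B^n$: when $X$ is executed with register $\mathrm{in}{:}j$ initialised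 to $b_j$ ($j\le n$) and all registers $\mathrm{aux}{:}i$ and $\mathrm{out}$ initialised to $F$, execution terminates without ever executing a basic instruction with focus $\mathrm{in}{:}j$ for $j>n$, and at termination register $\mathrm{out}$ contains $f(b_1,\dots,b_n)$. $\mathrm{P}^*_{\mathrm{lis}}$ is the class of Boolean function families $(f_n)_{n\in\mathbb N}$ ($f_n:\mathbb B^n\to\mathbb B$) for which there is a polynomial $h$ such that for every $n$ there is $X\in\mathrm{IS}_{br}$ computing $f_n$ with $|X|\le h(n)$. -}

module Defs where

open import Data.Bool.Base using (Bool; true; false; not; _∧_; _∨_; if_then_else_)
import Data.Bool.Properties as Bool
open import Data.Fin.Base as Fin using (Fin; toℕ; fromℕ<; inject≤)
import Data.Fin.Properties as Fin
open import Data.Fin.Subset.Properties using (anySubset?)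
open import Data.List.Base
  using (List; []; _∷_; _++_; [_]; map; concat; concatMap; drop; head; filter; allFin; length)
open import Data.List.Extrema.Nat using (max; xs≤max)
open import Data.List.NonEmpty.Base as List⁺ using (List⁺)
open import Data.List.Relation.Binary.BagAndSetEquality using (set; _∼[_]_; [_]-Equality)
open import Data.List.Relation.Unary.All as All using (All; []; _∷_)
import Data.List.Relation.Unary.All.Properties as All
open import Data.List.Relation.Unary.Any as Any using (Any; here; there)
open import Data.List.Relation.Unary.Unique.Propositional using (Unique)
open import Data.Maybe.Base using (Maybe; just; nothing; fromMaybe)
open import Data.Nat.Base
  using (ℕ; zero; suc; _+_; _*_; _≤_; _<_; z≤n; s≤s)
open import Data.Nat.Combinatorics using (_C_; nC1≡n; nCk+nC[k+1]≡[n+1]C[k+1])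
open import Data.Nat.Properties as ℕ using (_≤?_; _<?_)
open import Data.Product.Base using (Σ; ∃; ∃-syntax; _×_; _,_; proj₁; proj₂)
open import Data.Vec.Base as Vec using (Vec)
import Data.Vec.Properties as Vec
open import Function.Base using (_∘_)
open import Function.Bundles using (_⇔_; Bijection)
open import Level using (0ℓ)
open import Relation.Binary.Bundles using (Setoid)
import Relation.Binary.Construct.On as On
open import Relation.Binary.Definitions using (DecidableEquality)
open import Relation.Binary.PropositionalEquality
  using (_≡_; refl; sym; trans; cong; subst; subst₂; setoid)
open import Relation.Nullary.Decidable using (Dec; yes; no; does; map′)
open import Relation.Nullary.Negation using (contradiction)
open import Relation.Unary using (Pred)

-- The coefficient list a₀ ∷ a₁ ∷ … stands for a₀ + a₁ x + ….

Polynomial : Set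
Polynomial = List ℕ

⟦_⟧ : Polynomial → ℕ → ℕ
⟦ []    ⟧ x = 0
⟦ a ∷ p ⟧ x = a + x * ⟦ p ⟧ x

infix 9 _‼_

_‼_ : ∀ {A : Set} → List A → ℕ → Maybe A
xs ‼ i = head (drop i xs)

-- Binary notation without leading zeros, least significant bit first.

increment : List Bool → List Bool
increment []           = true ∷ []
increment (false ∷ bs) = true ∷ bs
increment (true  ∷ bs) = false ∷ increment bs

binary : ℕ → List Bool
binary zero    = []
binary (suc n) = increment (binary n)

------------------------------------------------------------------------
-- Propositional formulas

-- Variables are numbered from 0 here: pos i is vᵢ₊₁ and neg i is ¬vᵢ₊₁.

data Literal : Set where
  pos neg : ℕ → Literal

var : Literal → ℕ
var (pos i) = i
var (neg i) = i

Clause : Set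
Clause = List Literal

CNF : Set
CNF = List Clause

OneToThree : Clause → Set
OneToThree c = 1 ≤ length c × length c ≤ 3

Is3CNF : CNF → Set
Is3CNF = All OneToThree

Assignment : Set
Assignment = ℕ → Bool

value : Assignment → Literal → Bool
value σ (pos i) = σ i
value σ (neg i) = not (σ i)

_⊨_ : Assignment → CNF → Set
σ ⊨ φ = All (Any (λ l → value σ l ≡ true)) φ

Satisfiable : CNF → Set
Satisfiable φ = ∃[ σ ] σ ⊨ φ

module _ where
  private
    extend : ∀ {m} → Vec Bool m → Assignment
    extend {m} v i with i <? m
    ... | yes i<m = Vec.lookup v (fromℕ< i<m)
    ... | no  _   = false

    extend-tabulate : ∀ m (σ : Assignment) {i} → i < m →
                      extend (Vec.tabulate {n = m} (σ ∘ toℕ)) i ≡ σ i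
    extend-tabulate m σ {i} i<m with i <? m
    ... | yes p   = trans (Vec.lookup∘tabulate (σ ∘ toℕ) (fromℕ< p))
                          (cong σ (Fin.toℕ-fromℕ< p))
    ... | no  i≮m = contradiction i<m i≮m

    bound : CNF → ℕ
    bound φ = suc (max 0 (map var (concat φ)))

    bounded : ∀ φ → All (All (λ l → var l < bound φ)) φ
    bounded φ = All.concat⁻ (All.map s≤s (All.map⁻ (xs≤max 0 (map var (concat φ)))))

    value-cong : ∀ {σ τ : Assignment} l → σ (var l) ≡ τ (var l) → value σ l ≡ value τ l
    value-cong (pos i) eq = eq
    value-cong (neg i) eq = cong not eq

    clause-local : ∀ {m σ τ} → (∀ {i} → i < m → σ i ≡ τ i) →
                   ∀ {c} → All (λ l → var l < m) c →
                   Any (λ l → value σ l ≡ true) c → Any (λ l → value τ l ≡ true) c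
    clause-local eq {l ∷ _} (b ∷ _)  (here p)  = here (trans (sym (value-cong l (eq b))) p)
    clause-local eq         (_ ∷ bs) (there p) = there (clause-local eq bs p)

    local : ∀ {m σ τ} → (∀ {i} → i < m → σ i ≡ τ i) →
            ∀ {φ} → All (All (λ l → var l < m)) φ → σ ⊨ φ → τ ⊨ φ
    local eq []       []       = []
    local eq (b ∷ bs) (p ∷ ps) = clause-local eq b p ∷ local eq bs ps

    ⊨? : ∀ σ φ → Dec (σ ⊨ φ)
    ⊨? σ = All.all? (Any.any? (λ l → value σ l Bool.≟ true))

  satisfiable? : ∀ φ → Dec (Satisfiable φ)
  satisfiable? φ = map′
    (λ (v , p) → extend v , p)
    (λ (σ , p) → Vec.tabulate (σ ∘ toℕ) ,
                 local (λ i<m → sym (extend-tabulate (bound φ) σ i<m)) (bounded φ) p)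
    (anySubset? {n = bound φ} (λ v → ⊨? (extend v) φ))

------------------------------------------------------------------------
-- The language 3SAT

-- A formula is written over a four-letter alphabet, two bits per letter:
-- a literal is its sign, the binary notation of its (1-based) variable
-- index and a comma; a clause is its literals followed by a semicolon.

data Symbol : Set where
  bit             : Bool → Symbol
  comma semicolon : Symbol

symbolCode : Symbol → List Bool
symbolCode (bit b)   = false ∷ b ∷ []
symbolCode comma     = true ∷ false ∷ []
symbolCode semicolon = true ∷ true ∷ []

literalSymbols : Literal → List Symbol
literalSymbols (pos i) = bit true  ∷ map bit (binary (suc i)) ++ [ comma ]
literalSymbols (neg i) = bit false ∷ map bit (binary (suc i)) ++ [ comma ]

clauseSymbols : Clause → List Symbol
clauseSymbols c = concatMap literalSymbols c ++ [ semicolon ]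

encodeClause : Clause → List Bool
encodeClause c = concatMap symbolCode (clauseSymbols c)

encode : CNF → List Bool
encode = concatMap encodeClause

Language : Set₁
Language = Pred (List Bool) 0ℓ

3SAT : Language
3SAT w = ∃[ φ ] Is3CNF φ × Satisfiable φ × encode φ ≡ w

------------------------------------------------------------------------
-- Boolean circuits and P/poly

data Gate (w : ℕ) : Set where
  const   : Bool → Gate w
  ¬ᵍ_     : Fin w → Gate w
  _∧ᵍ_    : Fin w → Fin w → Gate w
  _∨ᵍ_    : Fin w → Fin w → Gate w

infixl 5 _▷_

-- Gates n s: s gates over n inputs, in topological order.  Wire 0 is the
-- most recent gate; the inputs come after all gates.

data Gates (n : ℕ) : ℕ → Set where
  []  : Gates n 0
  _▷_ : ∀ {s} → Gates n s → Gate (s + n) → Gates n (suc s)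

record Circuit (n : ℕ) : Set where
  field
    size   : ℕ
    gates  : Gates n size
    output : Fin (size + n)

gateValue : ∀ {w} → Gate w → Vec Bool w → Bool
gateValue (const b) v = b
gateValue (¬ᵍ i)    v = not (Vec.lookup v i)
gateValue (i ∧ᵍ j)  v = Vec.lookup v i ∧ Vec.lookup v j
gateValue (i ∨ᵍ j)  v = Vec.lookup v i ∨ Vec.lookup v j

wireValues : ∀ {n s} → Gates n s → Vec Bool n → Vec Bool (s + n)
wireValues []       x = x
wireValues (gs ▷ g) x = gateValue g (wireValues gs x) Vec.∷ wireValues gs x

evaluate : ∀ {n} → Circuit n → Vec Bool n → Bool
evaluate C x = Vec.lookup (wireValues gates x) output
  where open Circuit C

P/poly : Pred Language 0ℓ
P/poly L = Σ (∀ n → Circuit n) λ C → ∃[ h ] ∀ n →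
  Circuit.size (C n) ≤ ⟦ h ⟧ n ×
  (∀ (x : Vec Bool n) → evaluate (C n) x ≡ true ⇔ L (Vec.toList x))

------------------------------------------------------------------------
-- Polynomial-time computability, by deterministic one-tape Turing machines

data Move : Set where
  left stay right : Move

data Cell (extra : ℕ) : Set where
  blank : Cell extra
  bit   : Bool → Cell extra
  mark  : Fin extra → Cell extra

record TuringMachine : Set where
  field
    states : ℕ
    extra  : ℕ
    start  : Fin states
    δ      : Fin states → Cell extra → Maybe (Fin states × Cell extra × Move)
    -- nothing: the machine halts

module _ (M : TuringMachine) where
  open TuringMachine M

  -- The tape is infinite in both directions; cells not listed are blank,
  -- and leftward lists the cells left of the head from right to left.

  record Configuration : Set where
    constructor config
    field
      state     : Fin states
      leftward  : List (Cell extra)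
      scanned   : Cell extra
      rightward : List (Cell extra)

  move : Move → Fin states → List (Cell extra) → Cell extra → List (Cell extra) → Configuration
  move left  q []       c rs       = config q [] blank (c ∷ rs)
  move left  q (l ∷ ls) c rs       = config q ls l (c ∷ rs)
  move stay  q ls       c rs       = config q ls c rs
  move right q ls       c []       = config q (c ∷ ls) blank []
  move right q ls       c (r ∷ rs) = config q (c ∷ ls) r rs

  step : Configuration → Maybe Configuration
  step (config q ls c rs) with δ q c
  ... | nothing            = nothing
  ... | just (q′ , c′ , m) = just (move m q′ ls c′ rs)

  -- The halting configuration, if it is reached in at most t steps.

  run : ℕ → Configuration → Maybe Configuration
  run t κ with step κ
  run t       κ | nothing = just κ
  run zero    κ | just _  = nothing
  run (suc t) κ | just κ′ = run t κ′

  initial : List Bool → Configuration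
  initial []       = config start [] blank []
  initial (b ∷ bs) = config start [] (bit b) (map bit bs)

  leadingBits : List (Cell extra) → List Bool
  leadingBits (bit b ∷ cs) = b ∷ leadingBits cs
  leadingBits _            = []

  result : Configuration → List Bool
  result (config q ls c rs) = leadingBits (c ∷ rs)

  ComputesWithin : ℕ → List Bool → List Bool → Set
  ComputesWithin t x y = ∃[ κ ] run t (initial x) ≡ just κ × result κ ≡ y

-- Outputs are given by a representation relation because a value
-- (such as a finite set) may be written down in several ways.

PolynomialTime : ∀ {A B : Set} → (A → List Bool) → (List Bool → B → Set) → Pred (A → B) 0ℓ
PolynomialTime code _represents_ f =
  ∃[ M ] ∃[ p ] ∀ a → ∃[ y ]
    ComputesWithin M (⟦ p ⟧ (length (code a))) (code a) y × y represents f a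

------------------------------------------------------------------------
-- Enumerations of clauses

d : ℕ → ℕ
d k = (2 * k) C 1 + (2 * k) C 2 + (2 * k) C 3

module _ where
  private
    C-step : ∀ n k → n C suc k ≤ suc n C suc k
    C-step n k = subst (n C suc k ≤_) (nCk+nC[k+1]≡[n+1]C[k+1] n k) (ℕ.m≤n+m _ _)

    C-double : ∀ k j → (2 * k) C suc j ≤ (2 * suc k) C suc j
    C-double k j = subst (λ m → (2 * k) C suc j ≤ m C suc j) (sym (ℕ.*-suc 2 k))
                         (ℕ.≤-trans (C-step (2 * k) j) (C-step (suc (2 * k)) j))

  d-< : ∀ k → d k < d (suc k)
  d-< k = ℕ.+-mono-<-≤ (ℕ.+-mono-<-≤ C1-< (C-double k 1)) (C-double k 2)
    where
    C1-< : (2 * k) C 1 < (2 * suc k) C 1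
    C1-< = subst₂ _<_ (sym (nC1≡n (2 * k))) (sym (nC1≡n (2 * suc k)))
                  (ℕ.*-monoʳ-< 2 (ℕ.n<1+n k))

-- The k with d k ≤ n < d (suc k).

level : ℕ → ℕ
level zero    = 0
level (suc n) = if does (d (suc (level n)) ≤? suc n) then suc (level n) else level n

level-spec : ∀ n → d (level n) ≤ n × n < d (suc (level n))
level-spec zero    = z≤n , d-< 0
level-spec (suc n) = advance (level n) (level-spec n) (d (suc (level n)) ≤? suc n)
  where
  advance : ∀ l → d l ≤ n × n < d (suc l) → (d≤? : Dec (d (suc l) ≤ suc n)) →
            let l′ = if does d≤? then suc l else l in d l′ ≤ suc n × suc n < d (suc l′)
  advance l (_ , n<d) (yes d≤) = d≤ , ℕ.≤-<-trans n<d (d-< (suc l))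
  advance l (d≤n , _) (no d≰)  = ℕ.m≤n⇒m≤1+n d≤n , ℕ.≰⇒> d≰

-- Sets of one to three literals over v₁, …, vₖ; a set is a duplicate-free
-- list, taken up to having the same elements.

record LiteralSet (k : ℕ) : Set where
  field
    literals   : Clause
    unique     : Unique literals
    inRange    : All (λ l → var l < k) literals
    oneToThree : OneToThree literals

open LiteralSet public using (literals)

𝕃 : ℕ → Setoid 0ℓ 0ℓ
𝕃 k = On.setoid {B = LiteralSet k} ([ set ]-Equality Literal) literals

-- j : Fin (d k) stands for the element j + 1 of [1, d k].

ClauseBijections : Set
ClauseBijections = ∀ k → Bijection (setoid (Fin (d k))) (𝕃 k)

module _ (α : ClauseBijections) where

  clause : ∀ k → Fin (d k) → Clause
  clause k i = literals (Bijection.to (α k) i)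

  Coherent : Set
  Coherent = ∀ k (j : Fin (d k)) →
    clause (suc k) (inject≤ j (ℕ.<⇒≤ (d-< k))) ∼[ set ] clause k j

  -- The value of α at suc i.  By level-spec, suc (level i) is the least k
  -- with suc i ≤ d k.

  limit : ℕ → Clause
  limit i = clause (suc (level i)) (fromℕ< (proj₂ (level-spec i)))

_representsSet_ : List Bool → Clause → Set
y representsSet L = ∃[ c ] encodeClause c ≡ y × c ∼[ set ] L

record ClauseEnumeration : Set where
  field
    α              : ClauseBijections
    coherent       : Coherent α
    polynomialTime : PolynomialTime (binary ∘ suc) _representsSet_ (limit α)

------------------------------------------------------------------------
-- Boolean function families and 3SATᶜ

BooleanFunctionFamily : Set
BooleanFunctionFamily = ∀ n → Vec Bool n → Bool

selected : ClauseEnumeration → ∀ n → Vec Bool n → CNF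
selected E n b =
  map (clause α k) (filter (λ i → Vec.lookup b (inject≤ i d≤n) Bool.≟ true) (allFin (d k)))
  where
  open ClauseEnumeration E
  k   = level n
  d≤n = proj₁ (level-spec n)

3SATᶜ : ClauseEnumeration → BooleanFunctionFamily
3SATᶜ E n b = does (satisfiable? (selected E n b))

------------------------------------------------------------------------
-- Instruction sequences

-- Registers are numbered from 0 here: inp i is in:(i+1), aux i is aux:(i+1).

data Focus : Set where
  inp aux : ℕ → Focus
  out     : Focus

data Method : Set where
  set : Bool → Method
  get : Method

infix 8 _∙_

data BasicInstruction : Set where
  _∙_ : Focus → Method → BasicInstruction

focus : BasicInstruction → Focus
focus (f ∙ m) = f

data Instruction : Set where
  plain   : BasicInstruction → Instruction
  +test   : BasicInstruction → Instruction
  -test   : BasicInstruction → Instruction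
  jump    : ℕ → Instruction
  !       : Instruction

InstructionSequence : Set
InstructionSequence = List⁺ Instruction

data Allowed : BasicInstruction → Set where
  get-inp : ∀ {i}   → Allowed (inp i ∙ get)
  get-aux : ∀ {i}   → Allowed (aux i ∙ get)
  set-aux : ∀ {i b} → Allowed (aux i ∙ set b)
  set-out : ∀ {b}   → Allowed (out ∙ set b)

data AllowedInstruction : Instruction → Set where
  plain : ∀ {a} → Allowed a → AllowedInstruction (plain a)
  +test : ∀ {a} → Allowed a → AllowedInstruction (+test a)
  -test : ∀ {a} → Allowed a → AllowedInstruction (-test a)
  jump  : ∀ {l} → AllowedInstruction (jump l)
  !     : AllowedInstruction !

ISbr : Pred InstructionSequence 0ℓ
ISbr X = All AllowedInstruction (List⁺.toList X)

Registers : Set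
Registers = Focus → Bool

_≟ᶠ_ : DecidableEquality Focus
inp i ≟ᶠ inp j = map′ (cong inp) (λ { refl → refl }) (i ℕ.≟ j)
inp i ≟ᶠ aux j = no λ ()
inp i ≟ᶠ out   = no λ ()
aux i ≟ᶠ inp j = no λ ()
aux i ≟ᶠ aux j = map′ (cong aux) (λ { refl → refl }) (i ℕ.≟ j)
aux i ≟ᶠ out   = no λ ()
out   ≟ᶠ inp j = no λ ()
out   ≟ᶠ aux j = no λ ()
out   ≟ᶠ out   = yes refl

reply : BasicInstruction → Registers → Bool
reply (f ∙ set b) s = b
reply (f ∙ get)   s = s f

effect : BasicInstruction → Registers → Registers
effect (f ∙ set b) s g = if does (g ≟ᶠ f) then b else s g
effect (f ∙ get)   s   = s

-- Terminates X Ok i s s′: executing X from (0-based) position i with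
-- register contents s terminates with contents s′, and every basic
-- instruction executed on the way satisfies Ok.  Deadlock (past the end,
-- or at jump 0) is the absence of a rule.

data Terminates (X : InstructionSequence) (Ok : Pred BasicInstruction 0ℓ) :
                ℕ → Registers → Registers → Set where

  at-! : ∀ {i s} →
    List⁺.toList X ‼ i ≡ just ! →
    Terminates X Ok i s s

  at-jump : ∀ {i l s s′} →
    List⁺.toList X ‼ i ≡ just (jump (suc l)) →
    Terminates X Ok (i + suc l) s s′ →
    Terminates X Ok i s s′

  at-plain : ∀ {i a s s′} →
    List⁺.toList X ‼ i ≡ just (plain a) → Ok a →
    Terminates X Ok (i + 1) (effect a s) s′ →
    Terminates X Ok i s s′

  at-+test : ∀ {i a s s′} →
    List⁺.toList X ‼ i ≡ just (+test a) → Ok a →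
    Terminates X Ok (if reply a s then i + 1 else i + 2) (effect a s) s′ →
    Terminates X Ok i s s′

  at--test : ∀ {i a s s′} →
    List⁺.toList X ‼ i ≡ just (-test a) → Ok a →
    Terminates X Ok (if reply a s then i + 2 else i + 1) (effect a s) s′ →
    Terminates X Ok i s s′

-- The contents of input registers beyond the n-th are immaterial, because
-- Computes forbids executing instructions on them.

initialRegisters : ∀ {n} → Vec Bool n → Registers
initialRegisters b (inp j) = fromMaybe false (Vec.toList b ‼ j)
initialRegisters b (aux i) = false
initialRegisters b out     = false

InputsBelow : ℕ → Pred BasicInstruction 0ℓ
InputsBelow n a = ∀ j → focus a ≡ inp j → j < n

Computes : ∀ {n} → InstructionSequence → (Vec Bool n → Bool) → Set
Computes {n} X f = ∀ b → ∃[ s ]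
  Terminates X (InputsBelow n) 0 (initialRegisters b) s × s out ≡ f b

P*lis : Pred BooleanFunctionFamily 0ℓ
P*lis f = ∃[ h ] ∀ n → ∃[ X ] ISbr X × Computes X (f n) × List⁺.length X ≤ ⟦ h ⟧ n

{-# OPTIONS --safe #-}

-- From circuits for 3SAT to instruction sequences for 3SATᶜ: the bits b select
-- clauses, and replacing each unselected clause by a tautology of the same code
-- length gives a formula whose encoding has a fixed length and bits depending
-- on at most one bᵢ each.  A circuit applied to it is evaluated by a straight
-- program that keeps every wire in its own auxiliary register.
--
-- Conversely, a word w of length n is read as a formula whose variables are
-- named by positions in w: position q names the variable whose binary index is
-- written right after q.  This removes the exponentially large variable
-- indices, so at level k ≥ n the clauses to select are those whose literals
-- name all literals of some clause of w (a variable may have many names, and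
-- all combinations are selected).  That condition and the syntax of w are
-- recursive functions of the suffixes of w, hence polynomial-size circuits, and
-- an instruction sequence, whose jumps are all forward, becomes a circuit in
-- one pass over its instructions.

module Submission where

open import Defs
open import Data.Bool.Base using (Bool; true; false; not; _∧_; _∨_; if_then_else_)
open import Data.Bool.ListAction using (all; any)
import Data.Bool.Properties as Bool
open import Data.Empty using (⊥)
open import Data.Fin.Base using (Fin; zero; suc; fromℕ; fromℕ<; toℕ; inject≤; opposite)
open import Data.Fin.Properties using (toℕ-inject≤; toℕ-inject₁; toℕ-fromℕ; fromℕ<-toℕ; toℕ<n)
open import Data.List.Base as List
  using (List; []; _∷_; _++_; [_]; length; map; drop; upTo; concatMap; foldr; deduplicate; allFin; zip)
import Data.List.Membership.DecPropositional as DecMembership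
open import Data.List.Membership.Propositional using (_∈_; find; lose)
open import Data.List.Membership.Propositional.Properties
  using (∈-map⁺; ∈-map⁻; ∈-filter⁺; ∈-filter⁻; ∈-allFin; ∈-upTo⁺; ∈-upTo⁻; deduplicate-∈⇔)
open import Data.List.NonEmpty.Base as List⁺ using (List⁺)
open import Data.List.Properties
  using (++-assoc; ++-identityʳ; ++-cancelˡ; ∷-injective; ∷-injectiveʳ; ≡-dec; length-++; length-map;
         length-upTo; length-tabulate; length-zipWith; length-deduplicate; map-++; map-∘;
         concatMap-++; concatMap-map; map-concatMap; concatMap-cong)
open import Data.List.Relation.Unary.All as All using (All; []; _∷_)
open import Data.List.Relation.Unary.All.Properties using (++⁺)
open import Data.List.Relation.Unary.Any using (Any; here; there)
open import Data.List.Relation.Unary.Unique.DecPropositional.Properties using (deduplicate-!)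
open import Data.Maybe.Base as Maybe using (Maybe; just; nothing; maybe′; fromMaybe)
open import Data.Maybe.Properties using (just-injective)
open import Data.Nat.Base hiding (_/_; less)
open import Data.Nat.Combinatorics using (_C_; nCk+nC[k+1]≡[n+1]C[k+1])
open import Data.Nat.ListAction using (sum)
open import Data.Nat.ListAction.Properties using (sum-++)
open import Data.Nat.Properties
open import Data.Nat.Tactic.RingSolver using (solve-∀)
open import Data.Product.Base using (∃-syntax; _×_; _,_; proj₁; proj₂)
open import Data.Sum.Base using (_⊎_; inj₁; inj₂)
open import Data.Unit.Base using (⊤; tt)
open import Data.Vec.Base as Vec using (Vec; []; _∷_; toList; fromList)
open import Data.Vec.Properties using (lookup∘tabulate; toList-map; toList∘fromList)
open import Function.Base using (_∘_; id)
open import Function.Bundles using (_⇔_; mk⇔; Bijection; Equivalence)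
open import Relation.Binary.Definitions using (DecidableEquality)
open import Relation.Binary.PropositionalEquality hiding ([_])
open import Relation.Nullary.Decidable using (Dec; does; yes; no; map′; dec-true; dec-false)
open import Relation.Nullary.Negation using (contradiction)
open import Relation.Unary using (_∉_)

-- Circuits and instruction sequences are chosen separately for each length, so every `clause α k i`
-- is a constant of the construction: a question about it alone, such as which literals it contains,
-- is settled while building and costs no gates.
--
-- Naming by positions spares the circuit a compact renumbering of variables, which would take
-- comparing and counting occurrences. Redundant names do no harm: a model of the formula gives all
-- names of a variable the same value and so satisfies every selected clause; conversely, the
-- selected clauses that use only the first name of each variable already carry the whole formula. A
-- word of length `n` has at most `n` symbol positions, so `n` variables are enough, and `3SATᶜ`
-- offers them at length `d n`, which is cubic in `n`.
--
-- In the other direction an unselected clause cannot simply be omitted, since the length of the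
-- encoding, and with it the circuit to be used, would then depend on the selection.

-- Polynomially bounded functions

infixl 6 _⊕_
infixl 7 _⊛_

_⊕_ : Polynomial → Polynomial → Polynomial
[]      ⊕ q       = q
p@(_ ∷ _) ⊕ []    = p
(a ∷ p) ⊕ (b ∷ q) = a + b ∷ p ⊕ q

_⊛_ : Polynomial → Polynomial → Polynomial
[]      ⊛ q = []
(a ∷ p) ⊛ q = map (a *_) q ⊕ (0 ∷ p ⊛ q)

_⊚_ : Polynomial → Polynomial → Polynomial
[]      ⊚ q = []
(a ∷ p) ⊚ q = (a ∷ []) ⊕ q ⊛ (p ⊚ q)

⟦⊕⟧ : ∀ p q x → ⟦ p ⊕ q ⟧ x ≡ ⟦ p ⟧ x + ⟦ q ⟧ x
⟦⊕⟧ []      q       x = refl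
⟦⊕⟧ (a ∷ p) []      x = sym (+-identityʳ _)
⟦⊕⟧ (a ∷ p) (b ∷ q) x = trans (cong (λ y → a + b + x * y) (⟦⊕⟧ p q x))
                              (interchange a b x (⟦ p ⟧ x) (⟦ q ⟧ x))
  where
  interchange : ∀ a b x u v → a + b + x * (u + v) ≡ a + x * u + (b + x * v)
  interchange = solve-∀

⟦scale⟧ : ∀ a q x → ⟦ map (a *_) q ⟧ x ≡ a * ⟦ q ⟧ x
⟦scale⟧ a []      x = sym (*-zeroʳ a)
⟦scale⟧ a (b ∷ q) x = trans (cong (λ y → a * b + x * y) (⟦scale⟧ a q x))
                            (factor a b x (⟦ q ⟧ x))
  where
  factor : ∀ a b x v → a * b + x * (a * v) ≡ a * (b + x * v)
  factor = solve-∀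

⟦⊛⟧ : ∀ p q x → ⟦ p ⊛ q ⟧ x ≡ ⟦ p ⟧ x * ⟦ q ⟧ x
⟦⊛⟧ []      q x = refl
⟦⊛⟧ (a ∷ p) q x =
  trans (⟦⊕⟧ (map (a *_) q) (0 ∷ p ⊛ q) x)
        (trans (cong₂ (λ u v → u + x * v) (⟦scale⟧ a q x) (⟦⊛⟧ p q x))
               (factor a x (⟦ p ⟧ x) (⟦ q ⟧ x)))
  where
  factor : ∀ a x u v → a * v + x * (u * v) ≡ (a + x * u) * v
  factor = solve-∀

⟦⊚⟧ : ∀ p q x → ⟦ p ⊚ q ⟧ x ≡ ⟦ p ⟧ (⟦ q ⟧ x)
⟦⊚⟧ []      q x = refl
⟦⊚⟧ (a ∷ p) q x =
  trans (⟦⊕⟧ (a ∷ []) (q ⊛ (p ⊚ q)) x)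
        (cong₂ _+_ (trans (cong (a +_) (*-zeroʳ x)) (+-identityʳ a))
                   (trans (⟦⊛⟧ q (p ⊚ q) x) (cong (⟦ q ⟧ x *_) (⟦⊚⟧ p q x))))

⟦⟧-mono : ∀ p {x y} → x ≤ y → ⟦ p ⟧ x ≤ ⟦ p ⟧ y
⟦⟧-mono []      x≤y = z≤n
⟦⟧-mono (a ∷ p) x≤y = +-monoʳ-≤ a (*-mono-≤ x≤y (⟦⟧-mono p x≤y))

-- The closure lemmas below, one per operation that occurs in a size bound, replace the computation
-- of explicit polynomials.
Bounded : (ℕ → ℕ) → Set
Bounded f = ∃[ p ] ∀ n → f n ≤ ⟦ p ⟧ n

bounded-const : ∀ c → Bounded (λ _ → c)
bounded-const c = c ∷ [] , λ n → m≤m+n c _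

bounded-id : Bounded (λ n → n)
bounded-id = 0 ∷ 1 ∷ [] , λ n → ≤-reflexive (sym (trans (cong (λ y → n * suc y) (*-zeroʳ n)) (*-identityʳ n)))

bounded-+ : ∀ {f g} → Bounded f → Bounded g → Bounded (λ n → f n + g n)
bounded-+ (p , f≤) (q , g≤) =
  p ⊕ q , λ n → ≤-trans (+-mono-≤ (f≤ n) (g≤ n)) (≤-reflexive (sym (⟦⊕⟧ p q n)))

bounded-* : ∀ {f g} → Bounded f → Bounded g → Bounded (λ n → f n * g n)
bounded-* (p , f≤) (q , g≤) =
  p ⊛ q , λ n → ≤-trans (*-mono-≤ (f≤ n) (g≤ n)) (≤-reflexive (sym (⟦⊛⟧ p q n)))

bounded-∘ : ∀ h {f} → Bounded f → Bounded (λ n → ⟦ h ⟧ (f n))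
bounded-∘ h (q , f≤) =
  h ⊚ q , λ n → ≤-trans (⟦⟧-mono h (f≤ n)) (≤-reflexive (sym (⟦⊚⟧ h q n)))

bounded-≤ : ∀ {f g} → (∀ n → f n ≤ g n) → Bounded g → Bounded f
bounded-≤ f≤g (p , g≤) = p , λ n → ≤-trans (f≤g n) (g≤ n)

-- Pascal's rule and induction; this is what makes `d` polynomially bounded.
nCk≤n^k : ∀ n k → n C k ≤ n ^ k
nCk≤n^k n       zero    = ≤-refl
nCk≤n^k zero    (suc k) = z≤n
nCk≤n^k (suc n) (suc k) = begin
  suc n C suc k           ≡⟨ nCk+nC[k+1]≡[n+1]C[k+1] n k ⟨
  n C k + n C suc k       ≤⟨ +-mono-≤ (nCk≤n^k n k) (nCk≤n^k n (suc k)) ⟩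
  suc n * n ^ k           ≤⟨ *-monoʳ-≤ (suc n) (^-monoˡ-≤ k (n≤1+n n)) ⟩
  suc n ^ suc k           ∎
  where open ≤-Reasoning

bounded-^ : ∀ {f} → Bounded f → ∀ k → Bounded (λ n → f n ^ k)
bounded-^ b zero    = bounded-const 1
bounded-^ b (suc k) = bounded-* b (bounded-^ b k)

bounded-C : ∀ {f} → Bounded f → ∀ k → Bounded (λ n → f n C k)
bounded-C {f} b k = bounded-≤ (λ n → nCk≤n^k (f n) k) (bounded-^ b k)

bounded-d : Bounded d
bounded-d = bounded-+ (bounded-+ (bounded-C b 1) (bounded-C b 2)) (bounded-C b 3)
  where b = bounded-* (bounded-const 2) bounded-id

k≤d[k] : ∀ k → k ≤ d k
k≤d[k] zero    = z≤n
k≤d[k] (suc k) = ≤-trans (s≤s (k≤d[k] k)) (d-< k)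

d-mono : ∀ {k l} → k ≤ l → d k ≤ d l
d-mono {k} k≤l = go (≤⇒≤′ k≤l)
  where
  go : ∀ {l} → k ≤′ l → d k ≤ d l
  go ≤′-refl     = ≤-refl
  go {suc l} (≤′-step p) = ≤-trans (go p) (<⇒≤ (d-< l))

level-≤ : ∀ n → level n ≤ n
level-≤ n = ≤-trans (k≤d[k] (level n)) (proj₁ (level-spec n))

-- If `level (d k)` were below `k`, then `d (suc (level (d k))) ≤ d k` would contradict
-- `level-spec`. This makes `d n` inputs enough for `n` variables.
k≤level[d[k]] : ∀ k → k ≤ level (d k)
k≤level[d[k]] k = ≮⇒≥ λ l<k → <⇒≱ (proj₂ (level-spec (d k))) (d-mono l<k)

-- Unique decodability of the encoding of formulas

toNat : List Bool → ℕ
toNat []           = 0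
toNat (false ∷ bs) = 2 * toNat bs
toNat (true  ∷ bs) = suc (2 * toNat bs)

toNat-increment : ∀ bs → toNat (increment bs) ≡ suc (toNat bs)
toNat-increment []           = refl
toNat-increment (false ∷ bs) = refl
toNat-increment (true  ∷ bs) = trans (cong (2 *_) (toNat-increment bs)) (*-suc 2 (toNat bs))

toNat-binary : ∀ n → toNat (binary n) ≡ n
toNat-binary zero    = refl
toNat-binary (suc n) = trans (toNat-increment (binary n)) (cong suc (toNat-binary n))

binary-injective : ∀ {m n} → binary m ≡ binary n → m ≡ n
binary-injective {m} {n} eq = trans (sym (toNat-binary m)) (trans (cong toNat eq) (toNat-binary n))

binary-even : ∀ n → binary (2 * suc n) ≡ false ∷ binary (suc n)
binary-odd  : ∀ n → binary (suc (2 * n)) ≡ true ∷ binary n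

binary-even n = begin
  binary (2 * suc n)                  ≡⟨ cong binary (*-suc 2 n) ⟩
  increment (binary (suc (2 * n)))    ≡⟨ cong increment (binary-odd n) ⟩
  false ∷ binary (suc n)              ∎
  where open ≡-Reasoning
binary-odd zero    = refl
binary-odd (suc n) = cong increment (binary-even n)

binary-suc : ∀ n → ∃[ b ] ∃[ bs ] binary (suc n) ≡ b ∷ bs
binary-suc n with binary n
... | []         = _ , _ , refl
... | false ∷ bs = _ , _ , refl
... | true  ∷ bs = _ , _ , refl

-- The numerals without leading zeros are the b ∷ bs with endsTrue b bs.

endsTrue : Bool → List Bool → Bool
endsTrue b []        = b
endsTrue b (b′ ∷ bs) = endsTrue b′ bs

endsTrue-increment : ∀ b bs → endsTrue b bs ≡ true →
  ∀ {b′ bs′} → increment (b ∷ bs) ≡ b′ ∷ bs′ → endsTrue b′ bs′ ≡ true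
endsTrue-increment false (b ∷ bs)     eq refl = eq
endsTrue-increment true  []           eq refl = refl
endsTrue-increment true  (false ∷ bs) eq refl = endsTrue-increment false bs eq refl
endsTrue-increment true  (true ∷ bs)  eq refl = endsTrue-increment true bs eq refl

endsTrue-binary : ∀ n {b bs} → binary (suc n) ≡ b ∷ bs → endsTrue b bs ≡ true
endsTrue-binary zero    refl = refl
endsTrue-binary (suc n) eq with binary-suc n
... | b , bs , eq′ = endsTrue-increment b bs (endsTrue-binary n eq′) (trans (cong increment (sym eq′)) eq)

-- With `suc n` for the remaining digits, a zero in front stands for `2 * suc n` and a one for
-- `suc (2 * suc n)`. It recovers a variable index from the digits that the syntax automaton has
-- read.
binary-surjective : ∀ b bs → endsTrue b bs ≡ true → ∃[ n ] binary (suc n) ≡ b ∷ bs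
binary-surjective true  []       eq = 0 , refl
binary-surjective false (b ∷ bs) eq with binary-surjective b bs eq
... | n , eq′ = suc (2 * n) , trans (sym (cong binary (*-suc 2 n))) (trans (binary-even n) (cong (false ∷_) eq′))
binary-surjective true  (b ∷ bs) eq with binary-surjective b bs eq
... | n , eq′ = 2 * suc n , trans (binary-odd (suc n)) (cong (true ∷_) eq′)

length-increment : ∀ bs → length (increment bs) ≤ suc (length bs)
length-increment []           = ≤-refl
length-increment (false ∷ bs) = n≤1+n _
length-increment (true  ∷ bs) = s≤s (length-increment bs)

length-binary : ∀ n → length (binary n) ≤ n
length-binary zero    = z≤n
length-binary (suc n) = ≤-trans (length-increment (binary n)) (s≤s (length-binary n))

-- Prefixing a one turns `suc n` into `suc (2 * suc n)` and adds one digit. Numerals of prescribed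
-- length let a filler clause match the length of another clause.
binary-ofLength : ∀ l → ∃[ n ] length (binary (suc n)) ≡ suc l
binary-ofLength zero    = 0 , refl
binary-ofLength (suc l) with binary-ofLength l
... | n , eq = 2 * suc n , trans (cong length (binary-odd (suc n))) (cong suc eq)

sign : Literal → Bool
sign (pos _) = true
sign (neg _) = false

literal : Bool → ℕ → Literal
literal true  = pos
literal false = neg

literal-sign-var : ∀ l → literal (sign l) (var l) ≡ l
literal-sign-var (pos i) = refl
literal-sign-var (neg i) = refl

sign-literal : ∀ b i → sign (literal b i) ≡ b
sign-literal true  i = refl
sign-literal false i = refl

var-literal : ∀ b i → var (literal b i) ≡ i
var-literal true  i = refl
var-literal false i = refl

literalSymbols≡ : ∀ l → literalSymbols l ≡ bit (sign l) ∷ map bit (binary (suc (var l))) ++ [ comma ]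
literalSymbols≡ (pos i) = refl
literalSymbols≡ (neg i) = refl

literalSymbols-++ : ∀ l us → literalSymbols l ++ us ≡ bit (sign l) ∷ map bit (binary (suc (var l))) ++ comma ∷ us
literalSymbols-++ l us = trans (cong (_++ us) (literalSymbols≡ l)) (cong (bit (sign l) ∷_) (++-assoc (map bit _) [ comma ] us))

formulaSymbols : CNF → List Symbol
formulaSymbols = concatMap clauseSymbols

clauseSymbols-++ : ∀ l c us → clauseSymbols (l ∷ c) ++ us ≡ literalSymbols l ++ clauseSymbols c ++ us
clauseSymbols-++ l c us = trans (cong (_++ us) (++-assoc (literalSymbols l) (concatMap literalSymbols c) [ semicolon ]))
                                (++-assoc (literalSymbols l) (clauseSymbols c) us)

-- Nested to the right, so that functions scanning a symbol list from the left compute on it.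
clauseSymbols-∷ : ∀ l c us → clauseSymbols (l ∷ c) ++ us ≡
  bit (sign l) ∷ map bit (binary (suc (var l))) ++ comma ∷ clauseSymbols c ++ us
clauseSymbols-∷ l c us = trans (clauseSymbols-++ l c us) (literalSymbols-++ l (clauseSymbols c ++ us))

symbolCodes : List Symbol → List Bool
symbolCodes = concatMap symbolCode

symbolCodes-++ : ∀ us vs → symbolCodes (us ++ vs) ≡ symbolCodes us ++ symbolCodes vs
symbolCodes-++ = concatMap-++ symbolCode

encode≡ : ∀ φ → encode φ ≡ symbolCodes (formulaSymbols φ)
encode≡ []      = refl
encode≡ (c ∷ φ) = trans (cong (encodeClause c ++_) (encode≡ φ)) (sym (symbolCodes-++ (clauseSymbols c) _))

symbol : Bool → Bool → Symbol
symbol false b     = bit b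
symbol true  false = comma
symbol true  true  = semicolon

-- An odd bit at the end is dropped.

symbols : List Bool → List Symbol
symbols (a ∷ b ∷ w) = symbol a b ∷ symbols w
symbols _           = []

symbols-symbolCodes : ∀ us → symbols (symbolCodes us) ≡ us
symbols-symbolCodes []               = refl
symbols-symbolCodes (bit b ∷ us)     = cong (bit b ∷_) (symbols-symbolCodes us)
symbols-symbolCodes (comma ∷ us)     = cong (comma ∷_) (symbols-symbolCodes us)
symbols-symbolCodes (semicolon ∷ us) = cong (semicolon ∷_) (symbols-symbolCodes us)

symbolCode-symbol : ∀ a b → symbolCode (symbol a b) ≡ a ∷ b ∷ []
symbolCode-symbol false b     = refl
symbolCode-symbol true  false = refl
symbolCode-symbol true  true  = refl

evenLength : List Bool → Bool
evenLength []          = true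
evenLength (_ ∷ [])    = false
evenLength (_ ∷ _ ∷ w) = evenLength w

symbolCodes-symbols : ∀ w → evenLength w ≡ true → symbolCodes (symbols w) ≡ w
symbolCodes-symbols []          eq = refl
symbolCodes-symbols (a ∷ b ∷ w) eq = cong₂ _++_ (symbolCode-symbol a b) (symbolCodes-symbols w eq)

evenLength-symbolCodes : ∀ us → evenLength (symbolCodes us) ≡ true
evenLength-symbolCodes []               = refl
evenLength-symbolCodes (bit b ∷ us)     = evenLength-symbolCodes us
evenLength-symbolCodes (comma ∷ us)     = evenLength-symbolCodes us
evenLength-symbolCodes (semicolon ∷ us) = evenLength-symbolCodes us

leadingSymbolBits : List Symbol → List Bool
leadingSymbolBits (bit b ∷ us) = b ∷ leadingSymbolBits us
leadingSymbolBits _            = []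

leadingSymbolBits-map : ∀ bs us → leadingSymbolBits (map bit bs ++ comma ∷ us) ≡ bs
leadingSymbolBits-map []       us = refl
leadingSymbolBits-map (b ∷ bs) us = cong (b ∷_) (leadingSymbolBits-map bs us)

literal-injective : ∀ {l l′} → sign l ≡ sign l′ → var l ≡ var l′ → l ≡ l′
literal-injective {l} {l′} s v =
  trans (sym (literal-sign-var l)) (trans (cong₂ literal s v) (literal-sign-var l′))

-- A clause is self-delimiting: a bit starts a further literal, a semicolon ends the clause, and a
-- numeral is the run of bits before its comma. The remainders `us` and `us′` are included so that
-- the result can be iterated over a formula.
clauseSymbols-injective : ∀ c c′ {us us′} →
  clauseSymbols c ++ us ≡ clauseSymbols c′ ++ us′ → c ≡ c′ × us ≡ us′
clauseSymbols-injective []      []         refl = refl , refl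
clauseSymbols-injective []      (pos _ ∷ _) ()
clauseSymbols-injective []      (neg _ ∷ _) ()
clauseSymbols-injective (pos _ ∷ _) []     ()
clauseSymbols-injective (neg _ ∷ _) []     ()
clauseSymbols-injective (l ∷ c) (l′ ∷ c′) {us} {us′} eq =
  let (s , rest)  = ∷-injective (trans (sym (clauseSymbols-∷ l c us)) (trans eq (clauseSymbols-∷ l′ c′ us′)))
      bs≡bs′      = trans (sym (leadingSymbolBits-map (binary (suc (var l))) _))
                      (trans (cong leadingSymbolBits rest) (leadingSymbolBits-map (binary (suc (var l′))) _))
      rest′       = ++-cancelˡ (map bit (binary (suc (var l)))) _ _
                      (trans rest (cong (λ bs → map bit bs ++ comma ∷ clauseSymbols c′ ++ us′) (sym bs≡bs′)))
      (c≡c′ , us≡us′) = clauseSymbols-injective c c′ (∷-injectiveʳ rest′)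
  in cong₂ _∷_ (literal-injective (bit-injective s) (suc-injective (binary-injective bs≡bs′))) c≡c′ , us≡us′
  where
  bit-injective : ∀ {a b} → Symbol.bit a ≡ Symbol.bit b → a ≡ b
  bit-injective refl = refl

formulaSymbols-injective : ∀ φ ψ → formulaSymbols φ ≡ formulaSymbols ψ → φ ≡ ψ
formulaSymbols-injective []      []      eq = refl
formulaSymbols-injective []      ([] ∷ _) ()
formulaSymbols-injective []      ((pos _ ∷ _) ∷ _) ()
formulaSymbols-injective []      ((neg _ ∷ _) ∷ _) ()
formulaSymbols-injective ([] ∷ _) [] ()
formulaSymbols-injective ((pos _ ∷ _) ∷ _) [] ()
formulaSymbols-injective ((neg _ ∷ _) ∷ _) [] ()
formulaSymbols-injective (c ∷ φ) (e ∷ ψ) eq =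
  let (c≡e , rest) = clauseSymbols-injective c e eq
  in cong₂ _∷_ c≡e (formulaSymbols-injective φ ψ rest)

symbols-encode : ∀ φ → symbols (encode φ) ≡ formulaSymbols φ
symbols-encode φ = trans (cong symbols (encode≡ φ)) (symbols-symbolCodes (formulaSymbols φ))

encode-injective : ∀ φ ψ → encode φ ≡ encode ψ → φ ≡ ψ
encode-injective φ ψ eq = formulaSymbols-injective φ ψ
  (trans (sym (symbols-encode φ)) (trans (cong symbols eq) (symbols-encode ψ)))

-- `3SAT` only provides some formula with the given code; unique decodability identifies it with
-- `φ`.
satisfiable-encode : ∀ φ → 3SAT (encode φ) → Satisfiable φ
satisfiable-encode φ (ψ , _ , s , eq) = subst Satisfiable (encode-injective ψ φ eq) s

-- Building circuits gate by gate

infix  9 ~_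
infixr 8 _&_
infixr 7 _∣_

-- `signal k` is a wire built earlier and costs no gate, so sharing is expressed by building a
-- circuit in stages whose formulas refer to earlier ones.
data Formula (K : Set) (n : ℕ) : Set where
  signal  : K → Formula K n
  input   : Fin n → Formula K n
  const   : Bool → Formula K n
  ~_      : Formula K n → Formula K n
  _&_ _∣_ : Formula K n → Formula K n → Formula K n

eval : ∀ {K n} → (K → Bool) → Vec Bool n → Formula K n → Bool
eval S x (signal k) = S k
eval S x (input i)  = Vec.lookup x i
eval S x (const b)  = b
eval S x (~ φ)      = not (eval S x φ)
eval S x (φ & ψ)    = eval S x φ ∧ eval S x ψ
eval S x (φ ∣ ψ)    = eval S x φ ∨ eval S x ψ

cost : ∀ {K n} → Formula K n → ℕ
cost (signal k) = 0
cost (input i)  = 0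
cost (const b)  = 1
cost (~ φ)      = cost φ + 1
cost (φ & ψ)    = cost φ + (cost ψ + 1)
cost (φ ∣ ψ)    = cost φ + (cost ψ + 1)

Signal : ℕ → Set
Signal n = Vec Bool n → Bool

record Net (n : ℕ) : Set where
  constructor net
  field
    {size} : ℕ
    gates  : Gates n size

open Net

infix 4 _∋_ _⊑_

record _∋_ {n} (N : Net n) (f : Signal n) : Set where
  constructor _,_
  field
    wire    : Fin (size N + n)
    carries : ∀ x → Vec.lookup (wireValues (gates N) x) wire ≡ f x

-- Extension is expressed by the functions carried and not by wire numbers, because every new gate
-- becomes wire 0 and shifts all earlier wires.
_⊑_ : ∀ {n} → Net n → Net n → Set
N ⊑ N′ = ∀ {f} → N ∋ f → N′ ∋ f

-- With `stop` and `_⟫=_` this behaves like a monad graded by the number `c` of gates, so that the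
-- size bound of a circuit is read off the program that builds it.
record Reach {n} (N : Net n) (c : ℕ) (P : Net n → Set) : Set where
  constructor reach
  field
    target  : Net n
    growth  : size target ≤ size N + c
    extends : N ⊑ target
    holds   : P target

module _ {n : ℕ} where

  private variable
    N N′ : Net n
    P Q  : Net n → Set
    K    : Set
    S    : K → Signal n

  stop : P N → Reach N 0 P
  stop {N = N} p = reach N (≤-reflexive (sym (+-identityʳ _))) id p

  infixl 1 _⟫=_

  _⟫=_ : ∀ {c c′} → Reach N c P → (∀ {N′} → N ⊑ N′ → P N′ → Reach N′ c′ Q) → Reach N (c + c′) Q
  _⟫=_ {N = N} {c = c} {c′} (reach N′ s e p) f with f e p
  ... | reach N″ s′ e′ q =
    reach N″ (≤-trans s′ (≤-trans (+-monoˡ-≤ c′ s) (≤-reflexive (+-assoc (size N) c c′)))) (λ h → e′ (e h)) q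

  weaken : ∀ {c c′} → c ≤ c′ → Reach N c P → Reach N c′ P
  weaken {N = N} c≤c′ (reach N′ s e p) = reach N′ (≤-trans s (+-monoʳ-≤ (size N) c≤c′)) e p

  reach-map : ∀ {c} → (∀ {N} → P N → Q N) → Reach N c P → Reach N c Q
  reach-map f (reach N′ s e p) = reach N′ s e (f p)

  addGate : ∀ (N : Net n) (g : Gate (size N + n)) →
            Reach N 1 (_∋ λ x → gateValue g (wireValues (gates N) x))
  addGate N g = reach (net (gates N ▷ g)) (≤-reflexive (+-comm 1 (size N)))
                      (λ (i , p) → suc i , p) (zero , λ x → refl)

  ∋-resp : {f g : Signal n} → (∀ x → f x ≡ g x) → N ∋ f → N ∋ g
  ∋-resp eq (i , p) = i , λ x → trans (p x) (eq x)

  input-wire : (N : Net n) (i : Fin n) → N ∋ λ x → Vec.lookup x i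
  input-wire (net [])       i = i , λ x → refl
  input-wire (net (gs ▷ g)) i with input-wire (net gs) i
  ... | j , p = suc j , p

  _∋ᵃ_ : Net n → (K → Signal n) → Set
  N ∋ᵃ S = ∀ k → N ∋ S k

  realize : ∀ (N : Net n) → N ∋ᵃ S → (φ : Formula K n) →
            Reach N (cost φ) (_∋ λ x → eval (λ k → S k x) x φ)
  realize N s (signal k) = stop (s k)
  realize N s (input i)  = stop (input-wire N i)
  realize N s (const b)  = addGate N (const b)
  realize N s (~ φ)      =
    realize N s φ ⟫= λ { {N′} e (i , p) →
    reach-map (∋-resp λ x → cong not (p x)) (addGate N′ (¬ᵍ i)) }
  realize N s (φ & ψ)    =
    realize N s φ ⟫= λ {N′} e p →
    realize N′ (λ k → e (s k)) ψ ⟫= λ { {N″} e′ (j , q) →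
    let (i , p′) = e′ p in
    reach-map (∋-resp λ x → cong₂ _∧_ (p′ x) (q x)) (addGate N″ (i ∧ᵍ j)) }
  realize N s (φ ∣ ψ)    =
    realize N s φ ⟫= λ {N′} e p →
    realize N′ (λ k → e (s k)) ψ ⟫= λ { {N″} e′ (j , q) →
    let (i , p′) = e′ p in
    reach-map (∋-resp λ x → cong₂ _∨_ (p′ x) (q x)) (addGate N″ (i ∨ᵍ j)) }

  reach-all : ∀ {J : Set} {f : J → Signal n} {c} (js : List J) →
              (∀ {N′} → N ⊑ N′ → ∀ j → Reach N′ c (_∋ f j)) →
              Reach N (length js * c) (λ N′ → ∀ {j} → j ∈ js → N′ ∋ f j)
  reach-all []       r = stop λ ()
  reach-all (j ∷ js) r =
    r id j ⟫= λ {N′} e p →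
    (reach-all js (λ e′ → r (λ h → e′ (e h)))) ⟫=′ λ e′ q → λ { (here refl) → e′ p ; (there j∈) → q j∈ }
    where
    _⟫=′_ : ∀ {N c P Q} → Reach N c P → (∀ {N′} → N ⊑ N′ → P N′ → Q N′) → Reach N c Q
    (reach N′ s e p) ⟫=′ f = reach N′ s e (f e p)

  module _ (_≟_ : DecidableEquality K) where

    assign : K → Bool → (K → Bool) → K → Bool
    assign k b S k′ = if does (k′ ≟ k) then b else S k′

    -- Straight-line programs: in a circuit, an assignment adds the gates of its right-hand side and
    -- lets `k` denote the resulting wire. `K` may be infinite, since many signals may share one
    -- wire.
    exec : List (K × Formula K n) → Vec Bool n → (K → Bool) → K → Bool
    exec []             x S = S
    exec ((k , φ) ∷ as) x S = exec as x (assign k (eval S x φ) S)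

    reach-exec : ∀ (N : Net n) → N ∋ᵃ S → ∀ as →
                 Reach N (sum (map (cost ∘ proj₂) as)) (_∋ᵃ λ k x → exec as x (λ k → S k x) k)
    reach-exec N s []             = stop s
    reach-exec {S = S} N s ((k , φ) ∷ as) =
      realize N s φ ⟫= λ {N′} e p → reach-exec N′ (assigned e p) as
      where
      assigned : ∀ {N′} → N ⊑ N′ → N′ ∋ (λ x → eval (λ k → S k x) x φ) →
                 N′ ∋ᵃ λ k′ x → assign k (eval (λ k → S k x) x φ) (λ k → S k x) k′
      assigned e p k′ with k′ ≟ k
      ... | yes _ = p
      ... | no  _ = e (s k′)

-- Reading the input bits as symbols

pairAt : ∀ n → ℕ → Maybe (Fin n × Fin n)
pairAt (suc (suc n)) zero    = just (zero , suc zero)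
pairAt (suc (suc n)) (suc j) = Maybe.map (λ (a , b) → suc (suc a) , suc (suc b)) (pairAt n j)
pairAt _             _       = nothing

symbolsOf : ∀ {n} → Vec Bool n → List Symbol
symbolsOf x = symbols (toList x)

drop-pair : ∀ {n} j {a b} → pairAt n j ≡ just (a , b) → ∀ x →
  drop j (symbolsOf x) ≡ symbol (Vec.lookup x a) (Vec.lookup x b) ∷ drop (suc j) (symbolsOf x)
drop-pair {suc (suc n)} zero    refl (a ∷ b ∷ x) = refl
drop-pair {suc (suc n)} (suc j) eq   (a ∷ b ∷ x) with pairAt n j in eq′
drop-pair {suc (suc n)} (suc j) refl (a ∷ b ∷ x) | just _ = drop-pair j eq′ x

drop-noPair : ∀ {n} j → pairAt n j ≡ nothing → ∀ (x : Vec Bool n) → drop j (symbolsOf x) ≡ []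
drop-noPair zero    eq   []          = refl
drop-noPair zero    eq   (_ ∷ [])    = refl
drop-noPair (suc j) eq   []          = refl
drop-noPair (suc j) eq   (_ ∷ [])    = refl
drop-noPair {suc (suc n)} (suc j) eq (a ∷ b ∷ x) with pairAt n j in eq′
... | nothing = drop-noPair j eq′ x

drop-beyond : ∀ {n} j → n ≤ j → ∀ (x : Vec Bool n) → drop j (symbolsOf x) ≡ []
drop-beyond zero    z≤n     []          = refl
drop-beyond (suc j) n≤j     []          = refl
drop-beyond (suc j) n≤j     (_ ∷ [])    = refl
drop-beyond (suc j) (s≤s p) (a ∷ b ∷ x) = drop-beyond j (<⇒≤ p) x

mux : ∀ {K n} → Formula K n → Formula K n → Formula K n → Formula K n
mux a φ ψ = (a & φ) ∣ (~ a & ψ)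

eval-mux : ∀ {K n} (S : K → Bool) (x : Vec Bool n) a φ ψ →
           eval S x (mux a φ ψ) ≡ (if eval S x a then eval S x φ else eval S x ψ)
eval-mux S x a φ ψ with eval S x a
... | true  = Bool.∨-identityʳ _
... | false = refl

cost-mux : ∀ {K n} (i : Fin n) (φ ψ : Formula K n) {m} →
           cost φ ≤ m → cost ψ ≤ m → cost (mux (input i) φ ψ) ≤ 2 * m + 4
cost-mux i φ ψ {m} p q = ≤-trans
  (+-mono-≤ (+-monoˡ-≤ 1 p) (+-monoˡ-≤ 1 (+-monoʳ-≤ 1 (+-monoˡ-≤ 1 q))))
  (≤-reflexive (collect m))
  where
  collect : ∀ m → (m + 1) + ((1 + (m + 1)) + 1) ≡ 2 * m + 4
  collect = solve-∀

symbolCase : ∀ {K n} → Fin n → Fin n → (Symbol → Formula K n) → Formula K n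
symbolCase a b φ = mux (input a) (mux (input b) (φ semicolon) (φ comma))
                                 (mux (input b) (φ (bit true)) (φ (bit false)))

eval-symbolCase : ∀ {K n} (S : K → Bool) (x : Vec Bool n) a b φ →
  eval S x (symbolCase a b φ) ≡ eval S x (φ (symbol (Vec.lookup x a) (Vec.lookup x b)))
eval-symbolCase S x a b φ = trans (eval-mux S x (input a) (mux (input b) (φ semicolon) (φ comma)) (mux (input b) (φ (bit true)) (φ (bit false)))) (cases (Vec.lookup x a))
  where
  cases : ∀ c → (if c then eval S x (mux (input b) (φ semicolon) (φ comma))
                      else eval S x (mux (input b) (φ (bit true)) (φ (bit false))))
                ≡ eval S x (φ (symbol c (Vec.lookup x b)))
  cases true  with Vec.lookup x b | eval-mux S x (input b) (φ semicolon) (φ comma)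
  ... | true  | eq = eq
  ... | false | eq = eq
  cases false with Vec.lookup x b | eval-mux S x (input b) (φ (bit true)) (φ (bit false))
  ... | true  | eq = eq
  ... | false | eq = eq

-- Two nested multiplexers, one per code bit: each level doubles the cost of the branches and adds
-- four gates.
caseCost : ℕ → ℕ
caseCost m = 2 * (2 * m + 4) + 4

cost-symbolCase : ∀ {K n} (a b : Fin n) (φ : Symbol → Formula K n) {m} →
                  (∀ σ → cost (φ σ) ≤ m) → cost (symbolCase a b φ) ≤ caseCost m
cost-symbolCase a b φ p =
  cost-mux a (mux (input b) (φ semicolon) (φ comma)) (mux (input b) (φ (bit true)) (φ (bit false)))
    (cost-mux b (φ semicolon) (φ comma) (p semicolon) (p comma))
    (cost-mux b (φ (bit true)) (φ (bit false)) (p (bit true)) (p (bit false)))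

-- Functions of the suffixes of the input, each determined at a suffix σ ∷ u
-- by the values at u of all of them.

record SuffixRecursion (n : ℕ) (K : Set) : Set where
  field
    states    : List K
    complete  : ∀ k → k ∈ states
    scan       : Vec Bool n → K → List Symbol → Bool
    final     : K → Bool
    scan-[]    : ∀ x k → scan x k [] ≡ final k
    transition      : ℕ → K → Symbol → Formula K n
    scan-∷     : ∀ x k j σ → drop j (symbolsOf x) ≡ σ ∷ drop (suc j) (symbolsOf x) →
                scan x k (σ ∷ drop (suc j) (symbolsOf x)) ≡
                eval (λ k′ → scan x k′ (drop (suc j) (symbolsOf x))) x (transition j k σ)
    stepCost  : ℕ
    cost-transition : ∀ j k σ → cost (transition j k σ) ≤ stepCost

  layerCost : ℕ
  layerCost = length states * suc (caseCost stepCost)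

  value-at : ℕ → K → Signal n
  value-at j k x = scan x k (drop j (symbolsOf x))

  layer : ∀ (N : Net n) j → (formula : K → Formula K n) →
          (∀ k → cost (formula k) ≤ suc (caseCost stepCost)) →
          (S : K → Signal n) → N ∋ᵃ S →
          (∀ k x → value-at j k x ≡ eval (λ k′ → S k′ x) x (formula k)) →
          Reach N layerCost (_∋ᵃ value-at j)
  layer N j formula bound S s eq =
    reach-map (λ h k → h (complete k)) (reach-all states λ {N′} e k →
      weaken (bound k) (reach-map (∋-resp λ x → sym (eq k x)) (realize N′ (λ k′ → e (s k′)) (formula k))))

  reach-end : ∀ (N : Net n) j → (∀ x → drop j (symbolsOf x) ≡ []) →
              ∀ (S : K → Signal n) → N ∋ᵃ S → Reach N layerCost (_∋ᵃ value-at j)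
  reach-end N j end S s = layer N j (const ∘ final) (λ _ → s≤s z≤n) S s
    λ k x → trans (cong (scan x k) (end x)) (scan-[] x k)

  -- Layers are built from the end of the input towards its start. Each reads only the layer after
  -- it, so the size is linear in the number of positions. At `r` zero the position is at least `n`
  -- and the suffix is empty.
  reach-layer : ∀ (N : Net n) {S : K → Signal n} → N ∋ᵃ S → ∀ r j → n ≤ r + j →
                Reach N (suc r * layerCost) (_∋ᵃ value-at j)
  reach-layer N s zero    j n≤j = weaken (≤-reflexive (sym (*-identityˡ layerCost)))
                                         (reach-end N j (drop-beyond j n≤j) _ s)
  reach-layer N s (suc r) j n≤r = weaken (≤-reflexive (+-comm (suc r * layerCost) layerCost))
    (reach-layer N s r (suc j) (≤-trans n≤r (≤-reflexive (sym (+-suc r j)))) ⟫= λ {N′} _ s′ → extend N′ s′)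
    where
    extend : ∀ N′ → N′ ∋ᵃ value-at (suc j) → Reach N′ layerCost (_∋ᵃ value-at j)
    extend N′ s′ with pairAt n j in eq
    ... | nothing      = reach-end N′ j (drop-noPair j eq) _ s′
    ... | just (a , b) = layer N′ j (λ k → symbolCase a b (transition j k))
      (λ k → ≤-trans (cost-symbolCase a b (transition j k) (cost-transition j k)) (n≤1+n _)) _ s′
      λ k x → let open ≡-Reasoning in begin
        scan x k (drop j (symbolsOf x))
          ≡⟨ cong (scan x k) (drop-pair j eq x) ⟩
        scan x k (symbol (Vec.lookup x a) (Vec.lookup x b) ∷ drop (suc j) (symbolsOf x))
          ≡⟨ scan-∷ x k j _ (drop-pair j eq x) ⟩
        eval _ x (transition j k (symbol (Vec.lookup x a) (Vec.lookup x b)))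
          ≡⟨ eval-symbolCase _ x a b (transition j k) ⟨
        eval _ x (symbolCase a b (transition j k)) ∎

-- The syntax of encoded 3CNF formulas as a finite automaton

-- The number of further literals that the current clause may have.

data Room : Set where
  none one two : Room

room : Room → ℕ
room none = 0
room one  = 1
room two  = 2

-- `digits r b` remembers the last digit `b`: numerals are written from the least significant bit,
-- so leading zeros are excluded by demanding that the digit before a comma is a one.
data SyntaxState : Set where
  clauseStart  : SyntaxState
  literalStart : Room → SyntaxState
  afterSign    : Room → SyntaxState
  digits       : Room → Bool → SyntaxState

next : SyntaxState → Symbol → Maybe SyntaxState
next clauseStart          (bit _)   = just (afterSign two)
next clauseStart          _         = nothing
next (literalStart none)  (bit _)   = nothing
next (literalStart one)   (bit _)   = just (afterSign none)
next (literalStart two)   (bit _)   = just (afterSign one)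
next (literalStart _)     comma     = nothing
next (literalStart _)     semicolon = just clauseStart
next (afterSign r)        (bit b)   = just (digits r b)
next (afterSign r)        _         = nothing
next (digits r _)         (bit b)   = just (digits r b)
next (digits r true)      comma     = just (literalStart r)
next (digits r _)         _         = nothing

accepting : SyntaxState → Bool
accepting clauseStart = true
accepting _           = false

accepts : SyntaxState → List Symbol → Bool
accepts q []      = accepting q
accepts q (σ ∷ u) = maybe′ (λ q′ → accepts q′ u) false (next q σ)

-- The language accepted from each state, given for all states at once because the induction on the
-- word moves between them. In `digits r b` the numeral is partly read, and only its final digit is
-- still constrained.
Reads : SyntaxState → List Symbol → Set
Reads clauseStart      u = ∃[ φ ] Is3CNF φ × formulaSymbols φ ≡ u
Reads (literalStart r) u = ∃[ c ] ∃[ φ ] length c ≤ room r × Is3CNF φ ×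
  clauseSymbols c ++ formulaSymbols φ ≡ u
Reads (afterSign r)    u = ∃[ i ] ∃[ c ] ∃[ φ ] length c ≤ room r × Is3CNF φ ×
  map bit (binary (suc i)) ++ comma ∷ clauseSymbols c ++ formulaSymbols φ ≡ u
Reads (digits r b)     u = ∃[ bs ] ∃[ c ] ∃[ φ ] endsTrue b bs ≡ true × length c ≤ room r × Is3CNF φ ×
  map bit bs ++ comma ∷ clauseSymbols c ++ formulaSymbols φ ≡ u

prepend-literal : ∀ b i c us → clauseSymbols (literal b i ∷ c) ++ us ≡
  bit b ∷ map bit (binary (suc i)) ++ comma ∷ clauseSymbols c ++ us
prepend-literal b i c us = trans (clauseSymbols-∷ (literal b i) c us)
  (cong₂ (λ s v → bit s ∷ map bit (binary (suc v)) ++ comma ∷ clauseSymbols c ++ us)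
         (sign-literal b i) (var-literal b i))

accepts⇒Reads : ∀ q u → accepts q u ≡ true → Reads q u
accepts⇒Reads clauseStart [] _ = [] , [] , refl
accepts⇒Reads clauseStart (bit b ∷ u) eq with accepts⇒Reads (afterSign two) u eq
... | i , c , φ , c≤ , p , refl =
  (literal b i ∷ c) ∷ φ , (s≤s z≤n , s≤s c≤) ∷ p , prepend-literal b i c (formulaSymbols φ)
accepts⇒Reads (literalStart one) (bit b ∷ u) eq with accepts⇒Reads (afterSign none) u eq
... | i , c , φ , c≤ , p , refl =
  literal b i ∷ c , φ , s≤s c≤ , p , prepend-literal b i c (formulaSymbols φ)
accepts⇒Reads (literalStart two) (bit b ∷ u) eq with accepts⇒Reads (afterSign one) u eq
... | i , c , φ , c≤ , p , refl =
  literal b i ∷ c , φ , s≤s c≤ , p , prepend-literal b i c (formulaSymbols φ)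
accepts⇒Reads (literalStart none) (semicolon ∷ u) eq with accepts⇒Reads clauseStart u eq
... | φ , p , refl = [] , φ , z≤n , p , refl
accepts⇒Reads (literalStart one) (semicolon ∷ u) eq with accepts⇒Reads clauseStart u eq
... | φ , p , refl = [] , φ , z≤n , p , refl
accepts⇒Reads (literalStart two) (semicolon ∷ u) eq with accepts⇒Reads clauseStart u eq
... | φ , p , refl = [] , φ , z≤n , p , refl
accepts⇒Reads (afterSign r) (bit b ∷ u) eq with accepts⇒Reads (digits r b) u eq
... | bs , c , φ , ends , c≤ , p , refl with binary-surjective b bs ends
...   | i , eq′ = i , c , φ , c≤ , p , cong (λ bs → map bit bs ++ comma ∷ clauseSymbols c ++ formulaSymbols φ) eq′
accepts⇒Reads (digits r b) (bit b′ ∷ u) eq with accepts⇒Reads (digits r b′) u (trans (sym (digits-bit b)) eq)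
  where
  digits-bit : ∀ b → accepts (digits r b) (bit b′ ∷ u) ≡ accepts (digits r b′) u
  digits-bit true  = refl
  digits-bit false = refl
... | bs , c , φ , ends , c≤ , p , refl = b′ ∷ bs , c , φ , ends , c≤ , p , refl
accepts⇒Reads (digits r true) (comma ∷ u) eq with accepts⇒Reads (literalStart r) u eq
... | c , φ , c≤ , p , refl = [] , c , φ , refl , c≤ , p , refl

accepts-digits : ∀ r b bs u → endsTrue b bs ≡ true →
  accepts (digits r b) (map bit bs ++ comma ∷ u) ≡ accepts (literalStart r) u
accepts-digits r true  []        u eq = refl
accepts-digits r true  (b′ ∷ bs) u eq = accepts-digits r b′ bs u eq
accepts-digits r false (b′ ∷ bs) u eq = accepts-digits r b′ bs u eq

accepts-index : ∀ r i u →
  accepts (afterSign r) (map bit (binary (suc i)) ++ comma ∷ u) ≡ accepts (literalStart r) u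
accepts-index r i u with binary (suc i) in eq | binary-suc i
... | b ∷ bs | _ = accepts-digits r b bs u (endsTrue-binary i eq)

accepts-clauseTail : ∀ r c u → length c ≤ room r →
  accepts (literalStart r) (clauseSymbols c ++ u) ≡ accepts clauseStart u
accepts-clauseTail none []      u _ = refl
accepts-clauseTail one  []      u _ = refl
accepts-clauseTail two  []      u _ = refl
accepts-clauseTail one  (l ∷ c) u (s≤s c≤) =
  trans (cong (accepts (literalStart one)) (clauseSymbols-∷ l c u))
        (trans (accepts-index none (var l) _) (accepts-clauseTail none c u c≤))
accepts-clauseTail two  (l ∷ c) u (s≤s c≤) =
  trans (cong (accepts (literalStart two)) (clauseSymbols-∷ l c u))
        (trans (accepts-index one (var l) _) (accepts-clauseTail one c u c≤))

accepts-formula : ∀ φ → Is3CNF φ → accepts clauseStart (formulaSymbols φ) ≡ true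
accepts-formula []            []                  = refl
accepts-formula ((l ∷ c) ∷ φ) ((_ , s≤s c≤) ∷ p) =
  trans (cong (accepts clauseStart) (clauseSymbols-∷ l c (formulaSymbols φ)))
        (trans (accepts-index two (var l) _)
               (trans (accepts-clauseTail two c (formulaSymbols φ) c≤) (accepts-formula φ p)))

syntaxStates : List SyntaxState
syntaxStates =
  clauseStart ∷
  literalStart none ∷ literalStart one ∷ literalStart two ∷
  afterSign none ∷ afterSign one ∷ afterSign two ∷
  digits none false ∷ digits one false ∷ digits two false ∷
  digits none true ∷ digits one true ∷ digits two true ∷ []

syntaxStates-complete : ∀ q → q ∈ syntaxStates
syntaxStates-complete clauseStart         = here refl
syntaxStates-complete (literalStart none) = there (here refl)
syntaxStates-complete (literalStart one)  = there (there (here refl))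
syntaxStates-complete (literalStart two)  = there (there (there (here refl)))
syntaxStates-complete (afterSign none)    = there (there (there (there (here refl))))
syntaxStates-complete (afterSign one)     = there (there (there (there (there (here refl)))))
syntaxStates-complete (afterSign two)     = there (there (there (there (there (there (here refl))))))
syntaxStates-complete (digits none false) = there (there (there (there (there (there (there (here refl)))))))
syntaxStates-complete (digits one  false) = there (there (there (there (there (there (there (there (here refl))))))))
syntaxStates-complete (digits two  false) = there (there (there (there (there (there (there (there (there (here refl)))))))))
syntaxStates-complete (digits none true)  = there (there (there (there (there (there (there (there (there (there (here refl))))))))))
syntaxStates-complete (digits one  true)  = there (there (there (there (there (there (there (there (there (there (there (here refl)))))))))))
syntaxStates-complete (digits two  true)  = there (there (there (there (there (there (there (there (there (there (there (there (here refl))))))))))))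

syntaxRecursion : ∀ n → SuffixRecursion n SyntaxState
syntaxRecursion n = record
  { states          = syntaxStates
  ; complete        = syntaxStates-complete
  ; scan            = λ _ → accepts
  ; final           = accepting
  ; scan-[]         = λ _ _ → refl
  ; transition      = λ _ q σ → follow (next q σ)
  ; scan-∷          = λ x q j σ _ → eval-follow (drop (suc j) (symbolsOf x)) x (next q σ)
  ; stepCost        = 1
  ; cost-transition = λ _ q σ → cost-follow (next q σ)
  }
  where
  follow : Maybe SyntaxState → Formula SyntaxState n
  follow = maybe′ signal (const false)

  eval-follow : ∀ u (x : Vec Bool n) q → maybe′ (λ q′ → accepts q′ u) false q ≡
                eval (λ q′ → accepts q′ u) x (follow q)
  eval-follow u x (just _) = refl
  eval-follow u x nothing  = refl

  cost-follow : ∀ q → cost (follow q) ≤ 1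
  cost-follow (just _) = z≤n
  cost-follow nothing  = ≤-refl

-- Clauses over names of symbol positions

data ScanState : Set where
  atLiteral inLiteral atClause inClause : ScanState

-- The function m says which literals, given by sign and binary variable
-- index, are matched.

module _ (m : Bool → List Bool → Bool) where

  -- A nondeterministic reader with its alternatives made explicit: from `atClause`, either this
  -- clause is the matched one, and `atLiteral` and `inLiteral` check it up to its semicolon, or
  -- `inClause` skips it. A literal is tested as a whole at its sign; `inLiteral` then only passes
  -- over its digits.
  scanClauses : ScanState → List Symbol → Bool
  scanClauses atLiteral (bit b ∷ u)     = m b (leadingSymbolBits u) ∧ scanClauses inLiteral u
  scanClauses atLiteral (semicolon ∷ u) = true
  scanClauses inLiteral (bit b ∷ u)     = scanClauses inLiteral u
  scanClauses inLiteral (comma ∷ u)     = scanClauses atLiteral u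
  scanClauses atClause  (bit b ∷ u)     =
    (m b (leadingSymbolBits u) ∧ scanClauses inLiteral u) ∨ scanClauses inClause u
  -- An empty clause is matched vacuously, in agreement with `all`.
  scanClauses atClause  (semicolon ∷ u) = true
  scanClauses inClause  (semicolon ∷ u) = scanClauses atClause u
  scanClauses inClause  (bit _ ∷ u)     = scanClauses inClause u
  scanClauses inClause  (comma ∷ u)     = scanClauses inClause u
  scanClauses _         _               = false

  matched : Literal → Bool
  matched l = m (sign l) (binary (suc (var l)))

  scan-inLiteral : ∀ bs u → scanClauses inLiteral (map bit bs ++ comma ∷ u) ≡ scanClauses atLiteral u
  scan-inLiteral []       u = refl
  scan-inLiteral (b ∷ bs) u = scan-inLiteral bs u

  scan-inClause-bits : ∀ bs u → scanClauses inClause (map bit bs ++ comma ∷ u) ≡ scanClauses inClause u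
  scan-inClause-bits []       u = refl
  scan-inClause-bits (b ∷ bs) u = scan-inClause-bits bs u

  scan-inClause : ∀ c u → scanClauses inClause (clauseSymbols c ++ u) ≡ scanClauses atClause u
  scan-inClause []      u = refl
  scan-inClause (l ∷ c) u =
    trans (cong (scanClauses inClause) (clauseSymbols-∷ l c u))
          (trans (scan-inClause-bits (binary (suc (var l))) _) (scan-inClause c u))

  scan-literal : ∀ b i v → m b (leadingSymbolBits (map bit (binary (suc i)) ++ comma ∷ v)) ∧
                   scanClauses inLiteral (map bit (binary (suc i)) ++ comma ∷ v) ≡
                 m b (binary (suc i)) ∧ scanClauses atLiteral v
  scan-literal b i v = cong₂ (λ bs t → m b bs ∧ t)
    (leadingSymbolBits-map (binary (suc i)) v) (scan-inLiteral (binary (suc i)) v)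

  scan-atLiteral : ∀ c u → scanClauses atLiteral (clauseSymbols c ++ u) ≡ all matched c
  scan-atLiteral []      u = refl
  scan-atLiteral (l ∷ c) u =
    trans (cong (scanClauses atLiteral) (clauseSymbols-∷ l c u))
          (trans (scan-literal (sign l) (var l) (clauseSymbols c ++ u))
                 (cong (matched l ∧_) (scan-atLiteral c u)))

  scan-atClause : ∀ c u → scanClauses atClause (clauseSymbols c ++ u) ≡ all matched c ∨ scanClauses atClause u
  scan-atClause []      u = refl
  scan-atClause (l ∷ c) u = trans (cong (scanClauses atClause) (clauseSymbols-∷ l c u))
    (cong₂ _∨_
      (trans (scan-literal (sign l) (var l) (clauseSymbols c ++ u)) (cong (matched l ∧_) (scan-atLiteral c u)))
      (trans (scan-inClause-bits (binary (suc (var l))) _) (scan-inClause c u)))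

  scan-formula : ∀ φ → scanClauses atClause (formulaSymbols φ) ≡ any (all matched) φ
  scan-formula []      = refl
  scan-formula (c ∷ φ) = trans (scan-atClause c (formulaSymbols φ)) (cong (all matched c ∨_) (scan-formula φ))

-- Names of variables and the circuits that compare them

_≟ˡ_ : DecidableEquality Literal
pos i ≟ˡ pos j = map′ (cong pos) (λ { refl → refl }) (i ≟ j)
pos i ≟ˡ neg j = no λ ()
neg i ≟ˡ pos j = no λ ()
neg i ≟ˡ neg j = map′ (cong neg) (λ { refl → refl }) (i ≟ j)

open DecMembership _≟ˡ_ using (_∈?_)

-- Position `q` is meant to hold a sign, hence `suc q`. Positions inside a numeral may name a
-- variable as well, which does no harm.
name : List Symbol → ℕ → List Bool
name s q = leadingSymbolBits (drop (suc q) s)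

sameBits : List Bool → List Bool → Bool
sameBits as bs = does (≡-dec Bool._≟_ as bs)

-- Literals of c are named by symbol positions q < n; the name of q is
-- the bit sequence after q.

matches : ℕ → Clause → List Symbol → Bool → List Bool → Bool
matches n c s b bs = any (λ q → does (literal b q ∈? c) ∧ sameBits bs (name s q)) (upTo n)

isSeparator : List Symbol → Bool
isSeparator (bit _ ∷ _) = false
isSeparator _           = true

-- The values at separators are those of the second code bit, so that `bitAt` reads an input wire
-- without decoding; past the end both use `true`. In the same way `isSeparator` is the first code
-- bit.
headBit : List Symbol → Bool
headBit (bit b ∷ _)     = b
headBit (comma ∷ _)     = false
headBit (semicolon ∷ _) = true
headBit []              = true

iff : Bool → Bool → Bool
iff a b = (a ∧ b) ∨ (not a ∧ not b)

sameBits-unfold : ∀ u v → sameBits (leadingSymbolBits u) (leadingSymbolBits v) ≡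
  (isSeparator u ∧ isSeparator v) ∨
  ((not (isSeparator u) ∧ not (isSeparator v)) ∧
   (iff (headBit u) (headBit v) ∧ sameBits (leadingSymbolBits (drop 1 u)) (leadingSymbolBits (drop 1 v))))
sameBits-unfold []                 []                 = refl
sameBits-unfold []                 (bit _ ∷ v)        = refl
sameBits-unfold []                 (comma ∷ v)        = refl
sameBits-unfold []                 (semicolon ∷ v)    = refl
sameBits-unfold (comma ∷ u)        []                 = refl
sameBits-unfold (comma ∷ u)        (bit _ ∷ v)        = refl
sameBits-unfold (comma ∷ u)        (comma ∷ v)        = refl
sameBits-unfold (comma ∷ u)        (semicolon ∷ v)    = refl
sameBits-unfold (semicolon ∷ u)    []                 = refl
sameBits-unfold (semicolon ∷ u)    (bit _ ∷ v)        = refl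
sameBits-unfold (semicolon ∷ u)    (comma ∷ v)        = refl
sameBits-unfold (semicolon ∷ u)    (semicolon ∷ v)    = refl
sameBits-unfold (bit a ∷ u)        []                 = refl
sameBits-unfold (bit a ∷ u)        (comma ∷ v)        = refl
sameBits-unfold (bit a ∷ u)        (semicolon ∷ v)    = refl
sameBits-unfold (bit true ∷ u)     (bit true ∷ v)     = refl
sameBits-unfold (bit true ∷ u)     (bit false ∷ v)    = refl
sameBits-unfold (bit false ∷ u)    (bit true ∷ v)     = refl
sameBits-unfold (bit false ∷ u)    (bit false ∷ v)    = refl

drop-suc : ∀ {A : Set} j (xs : List A) → drop 1 (drop j xs) ≡ drop (suc j) xs
drop-suc zero    xs       = refl
drop-suc (suc j) []       = refl
drop-suc (suc j) (x ∷ xs) = drop-suc j xs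

module _ {K : Set} {n : ℕ} where

  separatorAt bitAt : ℕ → Formula K n
  separatorAt j = maybe′ (λ (a , b) → input a) (const true) (pairAt n j)
  bitAt       j = maybe′ (λ (a , b) → input b) (const true) (pairAt n j)

  -- `sameBits-unfold` applied once per symbol, `r` times. At `r` zero, position `p` is past the end
  -- and its run of bits is empty, so the runs agree exactly if the one at `q` is empty too.
  sameAt : ℕ → ℕ → ℕ → Formula K n
  sameAt zero    p q = separatorAt q
  sameAt (suc r) p q =
    (separatorAt p & separatorAt q) ∣
    ((~ separatorAt p & ~ separatorAt q) &
     ((bitAt p & bitAt q) ∣ (~ bitAt p & ~ bitAt q)) & sameAt r (suc p) (suc q))

  anyOf : List (Formula K n) → Formula K n
  anyOf = foldr _∣_ (const false)

  -- Membership in the constant clause `c` is decided while building; only the comparison of digits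
  -- becomes a circuit.
  matchesAt : Clause → Bool → ℕ → Formula K n
  matchesAt c b j = anyOf (map (λ q →
    if does (literal b q ∈? c) then sameAt n j (suc q) else const false) (upTo n))

  module _ (S : K → Bool) (x : Vec Bool n) where

    eval-separatorAt : ∀ j → eval S x (separatorAt j) ≡ isSeparator (drop j (symbolsOf x))
    eval-separatorAt j with pairAt n j in eq
    ... | nothing      = sym (cong isSeparator (drop-noPair j eq x))
    ... | just (a , b) = trans (sep (Vec.lookup x a) (Vec.lookup x b)) (sym (cong isSeparator (drop-pair j eq x)))
      where
      sep : ∀ a b {u} → a ≡ isSeparator (symbol a b ∷ u)
      sep false b     = refl
      sep true  false = refl
      sep true  true  = refl

    eval-bitAt : ∀ j → eval S x (bitAt j) ≡ headBit (drop j (symbolsOf x))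
    eval-bitAt j with pairAt n j in eq
    ... | nothing      = sym (cong headBit (drop-noPair j eq x))
    ... | just (a , b) = trans (head (Vec.lookup x a) (Vec.lookup x b)) (sym (cong headBit (drop-pair j eq x)))
      where
      head : ∀ a b {u} → b ≡ headBit (symbol a b ∷ u)
      head false b     = refl
      head true  false = refl
      head true  true  = refl

    eval-sameAt : ∀ r p q → n ≤ r + p → eval S x (sameAt r p q) ≡
      sameBits (leadingSymbolBits (drop p (symbolsOf x))) (leadingSymbolBits (drop q (symbolsOf x)))
    eval-sameAt zero    p q n≤p =
      trans (eval-separatorAt q)
            (trans (against-[] (drop q (symbolsOf x)))
                   (cong (λ u → sameBits (leadingSymbolBits u) _) (sym (drop-beyond p n≤p x))))
      where
      against-[] : ∀ v → isSeparator v ≡ sameBits [] (leadingSymbolBits v)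
      against-[] []              = refl
      against-[] (bit _ ∷ v)     = refl
      against-[] (comma ∷ v)     = refl
      against-[] (semicolon ∷ v) = refl
    eval-sameAt (suc r) p q n≤r
      rewrite eval-separatorAt p | eval-separatorAt q | eval-bitAt p | eval-bitAt q
            | eval-sameAt r (suc p) (suc q) (≤-trans n≤r (≤-reflexive (sym (+-suc r p))))
            | sameBits-unfold (drop p (symbolsOf x)) (drop q (symbolsOf x))
            | drop-suc p (symbolsOf x) | drop-suc q (symbolsOf x) = refl

    eval-anyOf : ∀ {A : Set} (f : A → Formula K n) as → eval S x (anyOf (map f as)) ≡ any (eval S x ∘ f) as
    eval-anyOf f []       = refl
    eval-anyOf f (a ∷ as) = cong (eval S x (f a) ∨_) (eval-anyOf f as)

    eval-matchesAt : ∀ c b j → eval S x (matchesAt c b j) ≡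
      matches n c (symbolsOf x) b (leadingSymbolBits (drop j (symbolsOf x)))
    eval-matchesAt c b j = trans (eval-anyOf _ (upTo n)) (any-cong pointwise (upTo n))
      where
      any-cong : ∀ {A : Set} {f g : A → Bool} → (∀ a → f a ≡ g a) → ∀ as → any f as ≡ any g as
      any-cong eq []       = refl
      any-cong eq (a ∷ as) = cong₂ _∨_ (eq a) (any-cong eq as)

      pointwise : ∀ q → eval S x (if does (literal b q ∈? c) then sameAt n j (suc q) else const false) ≡
        does (literal b q ∈? c) ∧ sameBits (leadingSymbolBits (drop j (symbolsOf x))) (name (symbolsOf x) q)
      pointwise q with does (literal b q ∈? c)
      ... | true  = eval-sameAt n j (suc q) (m≤m+n n j)
      ... | false = refl

  cost-separatorAt : ∀ j → cost (separatorAt j) ≤ 1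
  cost-separatorAt j with pairAt n j
  ... | nothing = ≤-refl
  ... | just _  = z≤n

  cost-bitAt : ∀ j → cost (bitAt j) ≤ 1
  cost-bitAt j with pairAt n j
  ... | nothing = ≤-refl
  ... | just _  = z≤n

  -- With one gate per atom, a symbol takes 3 gates for both runs ending, 5 for neither ending, 9
  -- for equal bits and 3 to connect these and the rest.
  cost-sameAt : ∀ r p q → cost (sameAt r p q) ≤ r * 20 + 1
  cost-sameAt zero    p q = cost-separatorAt q
  cost-sameAt (suc r) p q = ≤-trans
    (+-mono-≤ (+-mono-≤ (cost-separatorAt p) (+-monoˡ-≤ 1 (cost-separatorAt q))) (+-monoˡ-≤ 1
      (+-mono-≤ (+-mono-≤ (+-monoˡ-≤ 1 (cost-separatorAt p)) (+-monoˡ-≤ 1 (+-monoˡ-≤ 1 (cost-separatorAt q)))) (+-monoˡ-≤ 1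
        (+-mono-≤
          (+-mono-≤ (+-mono-≤ (cost-bitAt p) (+-monoˡ-≤ 1 (cost-bitAt q))) (+-monoˡ-≤ 1
            (+-mono-≤ (+-monoˡ-≤ 1 (cost-bitAt p)) (+-monoˡ-≤ 1 (+-monoˡ-≤ 1 (cost-bitAt q))))))
          (+-monoˡ-≤ 1 (cost-sameAt r (suc p) (suc q))))))))
    (≤-reflexive (collect (r * 20)))
    where
    collect : ∀ R → 3 + ((5 + ((9 + ((R + 1) + 1)) + 1)) + 1) ≡ 20 + R + 1
    collect = solve-∀

  cost-anyOf : ∀ {A : Set} (f : A → Formula K n) {m} → (∀ a → cost (f a) ≤ m) →
               ∀ as → cost (anyOf (map f as)) ≤ length as * (m + 1) + 1
  cost-anyOf f p []           = ≤-refl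
  cost-anyOf f {m} p (a ∷ as) = ≤-trans (+-mono-≤ (p a) (+-monoˡ-≤ 1 (cost-anyOf f p as)))
    (≤-reflexive (collect m (length as * (m + 1))))
    where
    collect : ∀ m k → m + (k + 1 + 1) ≡ m + 1 + k + 1
    collect = solve-∀

  matchCost : ℕ
  matchCost = n * (n * 20 + 1 + 1) + 1

  cost-matchesAt : ∀ c b j → cost (matchesAt c b j) ≤ matchCost
  cost-matchesAt c b j = ≤-trans (cost-anyOf _ bound (upTo n))
    (≤-reflexive (cong (λ l → l * (n * 20 + 1 + 1) + 1) (length-upTo n)))
    where
    bound : ∀ q → cost (if does (literal b q ∈? c) then sameAt n j (suc q) else const false) ≤ n * 20 + 1
    bound q with does (literal b q ∈? c)
    ... | true  = cost-sameAt n j (suc q)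
    ... | false = m≤n+m 1 (n * 20)

-- Here `scan` depends on the whole input: a literal of the suffix is compared with names at
-- arbitrary positions. The comparisons are formulas in the input bits and add no states.
scanRecursion : ∀ n → Clause → SuffixRecursion n ScanState
scanRecursion n c = record
  { states          = atLiteral ∷ inLiteral ∷ atClause ∷ inClause ∷ []
  ; complete        = λ { atLiteral → here refl
                        ; inLiteral → there (here refl)
                        ; atClause  → there (there (here refl))
                        ; inClause  → there (there (there (here refl))) }
  ; scan            = λ x → scanClauses (matches n c (symbolsOf x))
  ; final           = λ _ → false
  ; scan-[]         = λ { x atLiteral → refl ; x inLiteral → refl ; x atClause → refl ; x inClause → refl }
  ; transition      = transition
  ; scan-∷          = λ x k j σ _ → correct x k j σ
  ; stepCost        = n * (n * 20 + 1 + 1) + 1 + 2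
  ; cost-transition = bound
  }
  where
  transition : ℕ → ScanState → Symbol → Formula ScanState n
  transition j atLiteral (bit b)   = matchesAt c b (suc j) & signal inLiteral
  transition j atLiteral comma     = const false
  transition j atLiteral semicolon = const true
  transition j inLiteral (bit b)   = signal inLiteral
  transition j inLiteral comma     = signal atLiteral
  transition j inLiteral semicolon = const false
  transition j atClause  (bit b)   = (matchesAt c b (suc j) & signal inLiteral) ∣ signal inClause
  transition j atClause  comma     = const false
  transition j atClause  semicolon = const true
  transition j inClause  (bit b)   = signal inClause
  transition j inClause  comma     = signal inClause
  transition j inClause  semicolon = signal atClause

  correct : ∀ x k j σ → scanClauses (matches n c (symbolsOf x)) k (σ ∷ drop (suc j) (symbolsOf x)) ≡
    eval (λ k′ → scanClauses (matches n c (symbolsOf x)) k′ (drop (suc j) (symbolsOf x))) x (transition j k σ)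
  correct x atLiteral j (bit b)   = cong (_∧ _) (sym (eval-matchesAt _ x c b (suc j)))
  correct x atLiteral j comma     = refl
  correct x atLiteral j semicolon = refl
  correct x inLiteral j (bit b)   = refl
  correct x inLiteral j comma     = refl
  correct x inLiteral j semicolon = refl
  correct x atClause  j (bit b)   = cong (λ a → a ∧ _ ∨ _) (sym (eval-matchesAt _ x c b (suc j)))
  correct x atClause  j comma     = refl
  correct x atClause  j semicolon = refl
  correct x inClause  j (bit b)   = refl
  correct x inClause  j comma     = refl
  correct x inClause  j semicolon = refl

  bound : ∀ j k σ → cost (transition j k σ) ≤ n * (n * 20 + 1 + 1) + 1 + 2
  bound j atLiteral (bit b)   = +-mono-≤ (cost-matchesAt {K = ScanState} {n} c b (suc j)) (s≤s z≤n)
  bound j atLiteral comma     = ≤-trans (s≤s z≤n) (m≤n+m 2 _)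
  bound j atLiteral semicolon = ≤-trans (s≤s z≤n) (m≤n+m 2 _)
  bound j inLiteral (bit b)   = z≤n
  bound j inLiteral comma     = z≤n
  bound j inLiteral semicolon = ≤-trans (s≤s z≤n) (m≤n+m 2 _)
  bound j atClause  (bit b)   = ≤-trans (≤-reflexive (+-assoc (cost (matchesAt {K = ScanState} {n} c b (suc j))) 1 1))
                                        (+-monoˡ-≤ 2 (cost-matchesAt {K = ScanState} {n} c b (suc j)))
  bound j atClause  comma     = ≤-trans (s≤s z≤n) (m≤n+m 2 _)
  bound j atClause  semicolon = ≤-trans (s≤s z≤n) (m≤n+m 2 _)
  bound j inClause  (bit b)   = z≤n
  bound j inClause  comma     = z≤n
  bound j inClause  semicolon = z≤n

-- Soundness and completeness of the matching test

module _ {A : Set} (p : A → Bool) where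

  any-sound : ∀ {xs} → any p xs ≡ true → ∃[ a ] a ∈ xs × p a ≡ true
  any-sound {a ∷ xs} eq with p a in pa
  ... | true  = a , here refl , pa
  ... | false = let (b , b∈ , pb) = any-sound {xs} eq in b , there b∈ , pb

  any-complete : ∀ {a xs} → a ∈ xs → p a ≡ true → any p xs ≡ true
  any-complete         (here refl) eq rewrite eq = refl
  any-complete {xs = b ∷ _} (there a∈) eq with p b
  ... | true  = refl
  ... | false = any-complete a∈ eq

  all-sound : ∀ {a xs} → all p xs ≡ true → a ∈ xs → p a ≡ true
  all-sound {xs = b ∷ xs} eq (here refl) = Bool.∧-conicalˡ _ _ eq
  all-sound {xs = b ∷ xs} eq (there a∈)  = all-sound (Bool.∧-conicalʳ _ _ eq) a∈

  all-complete : ∀ {xs} → (∀ {a} → a ∈ xs → p a ≡ true) → all p xs ≡ true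
  all-complete {[]}     h = refl
  all-complete {a ∷ xs} h = cong₂ _∧_ (h (here refl)) (all-complete (λ a∈ → h (there a∈)))

does-sound : ∀ {A : Set} (a? : Dec A) → does a? ≡ true → A
does-sound (yes a) refl = a

_names_at_ : List Symbol → ℕ → ℕ → Set
s names i at q = binary (suc i) ≡ name s q

-- Only one inclusion is asked for: further literals in `c` make it weaker, so it still follows from
-- `e`, while the exact translation of `e` is among the covering clauses.
Covers : ℕ → List Symbol → CNF → Clause → Set
Covers n s φ c = ∃[ e ] e ∈ φ × (∀ {l} → l ∈ e →
  ∃[ q ] q < n × literal (sign l) q ∈ c × (s names var l at q))

covers-sound : ∀ n c s φ → any (all (matched (matches n c s))) φ ≡ true → Covers n s φ c
covers-sound n c s φ eq with any-sound _ eq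
... | e , e∈ , eq′ = e , e∈ , λ {l} l∈ →
  let (q , q∈ , h) = any-sound _ (all-sound (matched (matches n c s)) eq′ l∈)
  in q , ∈-upTo⁻ q∈ , does-sound (literal (sign l) q ∈? c) (Bool.∧-conicalˡ _ _ h) ,
     does-sound (≡-dec Bool._≟_ _ _) (Bool.∧-conicalʳ (does (literal (sign l) q ∈? c)) _ h)

covers-complete : ∀ n c s φ → Covers n s φ c → any (all (matched (matches n c s))) φ ≡ true
covers-complete n c s φ (e , e∈ , h) = any-complete _ e∈ (all-complete (matched (matches n c s)) λ {l} l∈ →
  let (q , q<n , q∈ , eq) = h l∈
  in any-complete _ (∈-upTo⁺ q<n) (cong₂ _∧_ (dec-true (literal (sign l) q ∈? c) q∈) (dec-true (≡-dec Bool._≟_ _ _) eq)))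

occurs-clause : ∀ {l c} → l ∈ c → ∀ us → ∃[ pre ] ∃[ v ]
  clauseSymbols c ++ us ≡ pre ++ bit (sign l) ∷ map bit (binary (suc (var l))) ++ comma ∷ v
occurs-clause {l} {_ ∷ c} (here refl) us = [] , clauseSymbols c ++ us , clauseSymbols-∷ l c us
occurs-clause {c = l′ ∷ c} (there l∈) us with occurs-clause l∈ us
... | pre , v , eq = literalSymbols l′ ++ pre , v ,
  trans (clauseSymbols-++ l′ c us) (trans (cong (literalSymbols l′ ++_) eq) (sym (++-assoc (literalSymbols l′) pre _)))

occurs-formula : ∀ {l e φ} → e ∈ φ → l ∈ e → ∃[ pre ] ∃[ v ]
  formulaSymbols φ ≡ pre ++ bit (sign l) ∷ map bit (binary (suc (var l))) ++ comma ∷ v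
occurs-formula {φ = e ∷ φ} (here refl) l∈ = occurs-clause l∈ (formulaSymbols φ)
occurs-formula {φ = c ∷ φ} (there e∈) l∈ with occurs-formula e∈ l∈
... | pre , v , eq = clauseSymbols c ++ pre , v ,
  trans (cong (clauseSymbols c ++_) eq) (sym (++-assoc (clauseSymbols c) pre _))

-- The name is the position of the sign of an occurrence, which is `length pre` in the decomposition
-- given by `occurs-formula`.
names-occurrence : ∀ {l e φ} → e ∈ φ → l ∈ e →
  ∃[ q ] q < length (formulaSymbols φ) × (formulaSymbols φ names var l at q)
names-occurrence {l} {φ = φ} e∈ l∈ with occurs-formula e∈ l∈
... | pre , v , eq rewrite eq = length pre , shorter , sym (reads pre)
  where
  shorter : length pre < length (pre ++ bit (sign l) ∷ map bit (binary (suc (var l))) ++ comma ∷ v)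
  shorter = ≤-trans (≤-reflexive (+-comm 1 (length pre)))
            (≤-trans (+-monoʳ-≤ (length pre) (s≤s z≤n)) (≤-reflexive (sym (length-++ pre))))
  reads : ∀ pre {b} → name (pre ++ bit b ∷ map bit (binary (suc (var l))) ++ comma ∷ v) (length pre) ≡ binary (suc (var l))
  reads []        = leadingSymbolBits-map (binary (suc (var l))) v
  reads (_ ∷ pre) = reads pre

-- The first name in the list serves as the canonical one; 0 is a default for variables without a
-- name there.
position : List Symbol → List ℕ → ℕ → ℕ
position s []       i = 0
position s (q ∷ qs) i = if sameBits (binary (suc i)) (name s q) then q else position s qs i

position-spec : ∀ s {q i} qs → q ∈ qs → s names i at q → position s qs i ∈ qs × (s names i at position s qs i)
position-spec s {q} {i} (q′ ∷ qs) q∈ h with ≡-dec Bool._≟_ (binary (suc i)) (name s q′)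
... | yes h′ = here refl , h′
position-spec s (q′ ∷ qs) (here refl) h | no ¬h = contradiction h ¬h
position-spec s (q′ ∷ qs) (there q∈)  h | no ¬h = let (p∈ , h′) = position-spec s qs q∈ h in there p∈ , h′

value-literal : ∀ τ σ l {q} → τ q ≡ σ (var l) → value τ (literal (sign l) q) ≡ value σ l
value-literal τ σ (pos i) eq = eq
value-literal τ σ (neg i) eq = cong not eq

-- Equisatisfiability of a formula and the clauses selected for it

module _ (E : ClauseEnumeration) where
  open ClauseEnumeration E

  module _ N (b : Vec Bool N) where

    private
      k   = level N
      d≤N = proj₁ (level-spec N)

    ∈-selected⁺ : ∀ i → Vec.lookup b (inject≤ i d≤N) ≡ true → clause α k i ∈ selected E N b
    ∈-selected⁺ i eq = ∈-map⁺ (clause α k) (∈-filter⁺ _ (∈-allFin i) eq)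

    ∈-selected⁻ : ∀ {c} → c ∈ selected E N b →
      ∃[ i ] c ≡ clause α k i × Vec.lookup b (inject≤ i d≤N) ≡ true
    ∈-selected⁻ c∈ with ∈-map⁻ (clause α k) c∈
    ... | i , i∈ , eq = i , eq , proj₂ (∈-filter⁻ _ {xs = allFin (d k)} i∈)

    module _ (n : ℕ) (φ : CNF) (3cnf : Is3CNF φ) (n≤k : n ≤ k) (short : length (formulaSymbols φ) ≤ n)
             (selects : ∀ i → Vec.lookup b (inject≤ i d≤N) ≡
                        any (all (matched (matches n (clause α k i) (formulaSymbols φ)))) φ) where

      private s = formulaSymbols φ

      -- Each position receives the value of the variable it names. A selected clause covers some
      -- clause of `φ`, and a true literal of the latter stays true under the name that the former
      -- contains.
      satisfiable-selected : Satisfiable φ → Satisfiable (selected E N b)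
      satisfiable-selected (σ , σ⊨φ) = τ , All.tabulate satisfies
        where
        τ : Assignment
        -- Numerals are 1-based, hence `pred`; a position with the empty name gets the value of
        -- variable 0.
        τ q = σ (pred (toNat (name s q)))

        satisfies : ∀ {c} → c ∈ selected E N b → Any (λ l → value τ l ≡ true) c
        satisfies c∈ with ∈-selected⁻ c∈
        ... | i , refl , sel with covers-sound n (clause α k i) s φ (trans (sym (selects i)) sel)
        ...   | e , e∈ , covers with find (All.lookup σ⊨φ e∈)
        ...     | l , l∈ , true-l with covers l∈
        ...       | q , q<n , q∈ , named = lose q∈ (trans (value-literal τ σ l same) true-l)
          where
          same : τ q ≡ σ (var l)
          same = cong (λ m → σ (pred m)) (trans (cong toNat (sym named)) (toNat-binary (suc (var l))))

      -- Each variable takes the value of its first name. Renaming a clause of `φ` by first names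
      -- yields a clause that covers it and is therefore selected, and whose literals are all
      -- renamed literals of the original.
      satisfiable-original : Satisfiable (selected E N b) → Satisfiable φ
      satisfiable-original (τ , τ⊨) = σ , All.tabulate satisfies
        where
        place : ℕ → ℕ
        place = position s (upTo n)

        σ : Assignment
        σ i = τ (place i)

        place-spec : ∀ {e l} → e ∈ φ → l ∈ e → place (var l) < n × (s names var l at place (var l))
        place-spec e∈ l∈ =
          let (q , q<s , named)  = names-occurrence e∈ l∈
              (p∈ , named′)    = position-spec s (upTo n) (∈-upTo⁺ (<-≤-trans q<s short)) named
          in ∈-upTo⁻ p∈ , named′

        rename : Literal → Literal
        rename l = literal (sign l) (place (var l))

        renamed : ∀ {e} → e ∈ φ → LiteralSet k
        renamed {e} e∈ = record
          -- A clause of `φ` may repeat a literal, whereas a `LiteralSet` may not.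
          { literals   = deduplicate _≟ˡ_ (map rename e)
          ; unique     = deduplicate-! _≟ˡ_ (map rename e)
          ; inRange    = All.tabulate λ l∈ → inRange (∈-map⁻ rename (Equivalence.from (deduplicate-∈⇔ _≟ˡ_) l∈))
          ; oneToThree = nonempty e (proj₁ (All.lookup 3cnf e∈)) ,
                         ≤-trans (length-deduplicate _≟ˡ_ (map rename e))
                           (≤-trans (≤-reflexive (length-map rename e)) (proj₂ (All.lookup 3cnf e∈)))
          }
          where
          inRange : ∀ {l} → ∃[ l′ ] l′ ∈ e × l ≡ rename l′ → var l < k
          inRange (l′ , l′∈ , refl) = ≤-trans
            (≤-reflexive (cong suc (var-literal (sign l′) _))) (≤-trans (proj₁ (place-spec e∈ l′∈)) n≤k)
          nonempty : ∀ e → 1 ≤ length e → 1 ≤ length (deduplicate _≟ˡ_ (map rename e))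
          nonempty (_ ∷ _) _ = s≤s z≤n

        satisfies : ∀ {e} → e ∈ φ → Any (λ l → value σ l ≡ true) e
        -- Surjectivity up to set equality finds the renamed clause in the enumeration.
        satisfies {e} e∈ with Bijection.strictlySurjective (α k) (renamed e∈)
        ... | i , c∼ with find (All.lookup τ⊨ (∈-selected⁺ i (trans (selects i) (covers-complete n (clause α k i) s φ covers))))
          where
          covers : Covers n s φ (clause α k i)
          covers = e , e∈ , λ {l} l∈ → place (var l) , proj₁ (place-spec e∈ l∈) ,
            Equivalence.from c∼ (Equivalence.to (deduplicate-∈⇔ _≟ˡ_) (∈-map⁺ rename l∈)) , proj₂ (place-spec e∈ l∈)
        ...   | l′ , l′∈ , true-l′ with ∈-map⁻ rename (Equivalence.from (deduplicate-∈⇔ _≟ˡ_) (Equivalence.to c∼ l′∈))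
        ...     | l , l∈ , refl = lose l∈ (trans (sym (value-literal τ σ l refl)) true-l′)

-- Circuits from instruction sequences

-- active i: control reaches position i.

data Track : Set where
  active   : ℕ → Track
  register : Focus → Track

_≟ᵗ_ : DecidableEquality Track
active i   ≟ᵗ active j   = map′ (cong active) (λ { refl → refl }) (i ≟ j)
active i   ≟ᵗ register g = no λ ()
register f ≟ᵗ active j   = no λ ()
register f ≟ᵗ register g = map′ (cong register) (λ { refl → refl }) (f ≟ᶠ g)

compare? : ∀ i j → i ≡ j × does (i ≟ j) ≡ true ⊎ does (i ≟ j) ≡ false
compare? i j = split (i ≟ j)
  where
  split : (i≟j : Dec (i ≡ j)) → i ≡ j × does i≟j ≡ true ⊎ does i≟j ≡ false
  split (yes eq) = inj₁ (eq , refl)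
  split (no _)   = inj₂ refl

-- The invariant before position `i` is processed. Control signals of earlier positions are
-- unconstrained, as they are not read again. `pc` is a set of positions in order to describe also
-- the halted state, where it is empty, and the states in the middle of an instruction.
record Holds (i : ℕ) (pc : ℕ → Bool) (s : Registers) (S : Track → Bool) : Set where
  constructor holds
  field
    control   : ∀ {j} → i ≤ j → S (active j) ≡ pc j
    registers : ∀ f → S (register f) ≡ s f

open Holds

put : ℕ → Bool → (ℕ → Bool) → ℕ → Bool
put t v pc j = if does (j ≟ t) then pc t ∨ v else pc j

only : ℕ → ℕ → Bool
only p j = does (j ≟ p)

put-false : ∀ pc t j → put t false pc j ≡ pc j
put-false pc t j with compare? j t
... | inj₁ (refl , eq) rewrite eq = Bool.∨-identityʳ (pc j)
... | inj₂ eq          rewrite eq = refl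

-- Position `i` itself stays marked, but only positions beyond it matter once it is processed.
put-true : ∀ {i p j} → i < p → i < j → put p true (only i) j ≡ only p j
put-true {i} {p} {j} i<p i<j with compare? j p
... | inj₁ (_ , eq) rewrite eq = Bool.∨-zeroʳ (only i p)
... | inj₂ eq       rewrite eq = dec-false (j ≟ i) (≢-sym (<⇒≢ i<j))

only-here : ∀ i → only i i ≡ true
only-here i = dec-true (i ≟ i) refl

put-elsewhere : ∀ {i t} v pc → i < t → put t v pc i ≡ pc i
put-elsewhere {i} {t} v pc i<t rewrite dec-false (i ≟ t) (<⇒≢ i<t) = refl

i<i+suc : ∀ {i} l → i < i + suc l
i<i+suc {i} l = m<m+n i (s≤s z≤n)

∧-off : ∀ {a} b → a ≡ false → a ∧ b ≡ false
∧-off b refl = refl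

module _ {n : ℕ} where

  reach-position : ℕ → Formula Track n → Track × Formula Track n
  reach-position t φ = active t , signal (active t) ∣ φ

  replyFormula : BasicInstruction → Formula Track n
  replyFormula (f ∙ set b) = const b
  replyFormula (f ∙ get)   = signal (register f)

  updates : ℕ → BasicInstruction → List (Track × Formula Track n)
  updates i (f ∙ set b) = (register f , mux (signal (active i)) (const b) (signal (register f))) ∷ []
  updates i (f ∙ get)   = []

  -- Control is or-ed into a target because several instructions may lead there. Termination and
  -- deadlock both pass control to no position; `Computes` guarantees that it is termination.
  assignments : ℕ → Instruction → List (Track × Formula Track n)
  assignments i (plain a)      = reach-position (i + 1) (signal (active i)) ∷ updates i a
  assignments i (+test a)      = reach-position (i + 1) (signal (active i) & replyFormula a) ∷
                                 reach-position (i + 2) (signal (active i) & ~ replyFormula a) ∷ updates i a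
  assignments i (-test a)      = reach-position (i + 2) (signal (active i) & replyFormula a) ∷
                                 reach-position (i + 1) (signal (active i) & ~ replyFormula a) ∷ updates i a
  assignments i (jump zero)    = []
  assignments i (jump (suc l)) = reach-position (i + suc l) (signal (active i)) ∷ []
  assignments i !              = []

  program : ℕ → List Instruction → List (Track × Formula Track n)
  program i []       = []
  program i (u ∷ us) = assignments i u ++ program (suc i) us

  totalCost : List (Track × Formula Track n) → ℕ
  totalCost as = sum (map (cost ∘ proj₂) as)

  cost-replyFormula : ∀ a → cost (replyFormula a) ≤ 1
  cost-replyFormula (f ∙ set b) = ≤-refl
  cost-replyFormula (f ∙ get)   = z≤n

  cost-updates : ∀ i a → totalCost (updates i a) ≤ 5
  cost-updates i (f ∙ set b) = ≤-refl
  cost-updates i (f ∙ get)   = z≤n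

  -- The worst case is a test: 3 and 4 gates for its two targets and 5 for the multiplexer of its
  -- update.
  cost-assignments : ∀ i u → totalCost (assignments i u) ≤ 12
  cost-assignments i (plain a)      = s≤s (≤-trans (cost-updates i a) (m≤n+m 5 6))
  cost-assignments i (+test a)      =
    +-mono-≤ {y = 3} {v = 9} (+-monoˡ-≤ 1 (+-monoˡ-≤ 1 (cost-replyFormula a)))
      (+-mono-≤ {y = 4} {v = 5} (+-monoˡ-≤ 1 (+-monoˡ-≤ 1 (+-monoˡ-≤ 1 (cost-replyFormula a)))) (cost-updates i a))
  cost-assignments i (-test a)      =
    +-mono-≤ {y = 3} {v = 9} (+-monoˡ-≤ 1 (+-monoˡ-≤ 1 (cost-replyFormula a)))
      (+-mono-≤ {y = 4} {v = 5} (+-monoˡ-≤ 1 (+-monoˡ-≤ 1 (+-monoˡ-≤ 1 (cost-replyFormula a)))) (cost-updates i a))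
  cost-assignments i (jump zero)    = z≤n
  cost-assignments i (jump (suc l)) = s≤s z≤n
  cost-assignments i !              = z≤n

  cost-program : ∀ i us → totalCost (program i us) ≤ length us * 12
  cost-program i []       = z≤n
  cost-program i (u ∷ us) = begin
    totalCost (assignments i u ++ program (suc i) us)
      ≡⟨ cong sum (map-++ (cost ∘ proj₂) (assignments i u) _) ⟩
    sum (map (cost ∘ proj₂) (assignments i u) ++ map (cost ∘ proj₂) (program (suc i) us))
      ≡⟨ sum-++ (map (cost ∘ proj₂) (assignments i u)) _ ⟩
    totalCost (assignments i u) + totalCost (program (suc i) us)
      ≤⟨ +-mono-≤ (cost-assignments i u) (cost-program (suc i) us) ⟩
    12 + length us * 12 ∎
    where open ≤-Reasoning

  execute : List (Track × Formula Track n) → Vec Bool n → (Track → Bool) → Track → Bool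
  execute = exec _≟ᵗ_

  execute-++ : ∀ as bs x S → execute (as ++ bs) x S ≡ execute bs x (execute as x S)
  execute-++ []             bs x S = refl
  execute-++ ((k , φ) ∷ as) bs x S = execute-++ as bs x _

  module _ {i : ℕ} where

    holds-≗ : ∀ {i′ pc pc′ s S} → i ≤ i′ → (∀ {j} → i′ ≤ j → pc j ≡ pc′ j) → Holds i pc s S → Holds i′ pc′ s S
    holds-≗ i≤i′ eq (holds c r) = holds (λ i′≤j → trans (c (≤-trans i≤i′ i′≤j)) (eq i′≤j)) r

    holds-put : ∀ {pc s S v} (x : Vec Bool n) t φ → i ≤ t → eval S x φ ≡ v → Holds i pc s S →
                Holds i (put t v pc) s (assign {n = n} _≟ᵗ_ (active t) (eval S x (signal (active t) ∣ φ)) S)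
    holds-put x t φ i≤t refl (holds c r) = holds
      (λ {j} i≤j → cong₂ (if does (j ≟ t) then_else_) (cong (_∨ _) (c i≤t)) (c i≤j)) r

    eval-reply : ∀ {pc s S} (x : Vec Bool n) a → Holds i pc s S → eval S x (replyFormula a) ≡ reply a s
    eval-reply x (f ∙ set b) h = refl
    eval-reply x (f ∙ get)   h = registers h f

    holds-updates-false : ∀ {pc s S} (x : Vec Bool n) a → pc i ≡ false → Holds i pc s S → Holds i pc s (execute (updates i a) x S)
    holds-updates-false x (f ∙ get)   off h = h
    holds-updates-false {S = S} x (f ∙ set b) off (holds c r) = holds c λ g → trans (unchanged g) (r g)
      where
      unchanged : ∀ g → (if does (g ≟ᶠ f) then eval S x (mux (signal (active i)) (const b) (signal (register f))) else S (register g))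
                        ≡ S (register g)
      unchanged g with g ≟ᶠ f
      ... | no  _    = refl
      ... | yes refl rewrite trans (c ≤-refl) off = refl

    holds-updates-true : ∀ {pc s S} (x : Vec Bool n) a → pc i ≡ true → Holds i pc s S → Holds i pc (effect a s) (execute (updates i a) x S)
    holds-updates-true x (f ∙ get)   on h = h
    holds-updates-true {s = s} {S} x (f ∙ set b) on (holds c r) = holds c updated
      where
      updated : ∀ g → (if does (g ≟ᶠ f) then eval S x (mux (signal (active i)) (const b) (signal (register f))) else S (register g))
                      ≡ (if does (g ≟ᶠ f) then b else s g)
      updated g with g ≟ᶠ f
      ... | no  _    = r g
      ... | yes refl rewrite trans (c ≤-refl) on = Bool.∨-identityʳ b

    holds-idle : ∀ {pc s S} (x : Vec Bool n) t φ → i ≤ t → eval S x φ ≡ false → Holds i pc s S →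
                 Holds i pc s (assign {n = n} _≟ᵗ_ (active t) (eval S x (signal (active t) ∣ φ)) S)
    holds-idle {pc} x t φ i≤t off h = holds-≗ ≤-refl (λ {j} _ → put-false pc t j) (holds-put x t φ i≤t off h)

    skip : ∀ {pc s S} (x : Vec Bool n) u → pc i ≡ false → Holds i pc s S → Holds i pc s (execute (assignments i u) x S)
    skip x (plain a) off h =
      let h₁ = holds-idle x (i + 1) (signal (active i)) (m≤m+n i 1) (trans (control h ≤-refl) off) h
      in holds-updates-false x a off h₁
    skip x (+test a) off h =
      let h₁ = holds-idle x (i + 1) (signal (active i) & replyFormula a) (m≤m+n i 1)
                 (∧-off _ (trans (control h ≤-refl) off)) h
          h₂ = holds-idle x (i + 2) (signal (active i) & ~ replyFormula a) (m≤m+n i 2)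
                 (∧-off _ (trans (control h₁ ≤-refl) off)) h₁
      in holds-updates-false x a off h₂
    skip x (-test a) off h =
      let h₁ = holds-idle x (i + 2) (signal (active i) & replyFormula a) (m≤m+n i 2)
                 (∧-off _ (trans (control h ≤-refl) off)) h
          h₂ = holds-idle x (i + 1) (signal (active i) & ~ replyFormula a) (m≤m+n i 1)
                 (∧-off _ (trans (control h₁ ≤-refl) off)) h₁
      in holds-updates-false x a off h₂
    skip x (jump zero)    off h = h
    skip x (jump (suc l)) off h =
      holds-idle x (i + suc l) (signal (active i)) (m≤m+n i (suc l)) (trans (control h ≤-refl) off) h
    skip x !              off h = h

    step-goto : ∀ {s S} (x : Vec Bool n) l φ a → eval S x φ ≡ true → Holds i (only i) s S →
      Holds (suc i) (only (i + suc l)) (effect a s)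
        (execute (reach-position (i + suc l) φ ∷ updates i a) x S)
    step-goto x l φ a on h = holds-≗ (n≤1+n i) (λ i<j → put-true (i<i+suc l) i<j)
      (holds-updates-true x a (trans (put-elsewhere {i} true (only i) (i<i+suc l)) (only-here i))
        (holds-put x (i + suc l) φ (m≤m+n i (suc l)) on h))

    step-test : ∀ {s S} (x : Vec Bool n) l l′ a → Holds i (only i) s S →
      Holds (suc i) (only (if reply a s then i + suc l else i + suc l′)) (effect a s)
        (execute (reach-position (i + suc l) (signal (active i) & replyFormula a) ∷
                  reach-position (i + suc l′) (signal (active i) & ~ replyFormula a) ∷ updates i a) x S)
    step-test {s} x l l′ a h with reply a s in eq
    ... | true  =
      let h₁ = holds-put {v = true} x (i + suc l) (signal (active i) & replyFormula a) (m≤m+n i (suc l))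
                 (cong₂ _∧_ (trans (control h ≤-refl) (only-here i)) (trans (eval-reply x a h) eq)) h
          on = trans (put-elsewhere {i} true (only i) (i<i+suc l)) (only-here i)
          h₂ = holds-idle x (i + suc l′) (signal (active i) & ~ replyFormula a) (m≤m+n i (suc l′))
                 (cong₂ (λ p r → p ∧ not r) (trans (control h₁ ≤-refl) on) (trans (eval-reply x a h₁) eq)) h₁
      in holds-≗ (n≤1+n i) (λ i<j → put-true (i<i+suc l) i<j) (holds-updates-true x a on h₂)
    ... | false =
      let h₁ = holds-idle x (i + suc l) (signal (active i) & replyFormula a) (m≤m+n i (suc l))
                 (cong₂ _∧_ (trans (control h ≤-refl) (only-here i)) (trans (eval-reply x a h) eq)) h
      in step-goto x l′ (signal (active i) & ~ replyFormula a) a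
           (cong₂ (λ p r → p ∧ not r) (trans (control h₁ ≤-refl) (only-here i)) (trans (eval-reply x a h₁) eq)) h₁

  -- With no active position every multiplexer keeps the old content, so the registers at `!`
  -- survive the rest of the pass.
  halted : ∀ {i s S} us x → Holds i (λ _ → false) s S → execute (program i us) x S (register out) ≡ s out
  halted []       x h = registers h out
  halted {i} {S = S} (u ∷ us) x h rewrite execute-++ (assignments i u) (program (suc i) us) x S =
    halted us x (holds-≗ (n≤1+n i) (λ _ → refl) (skip x u refl h))

  ‼-[] : ∀ k → ([] {A = Instruction}) ‼ k ≡ nothing
  ‼-[] zero    = refl
  ‼-[] (suc k) = refl

  instruction-at : ∀ {X Ok p s s′} → Terminates X Ok p s s′ → ∃[ u ] List⁺.toList X ‼ p ≡ just u
  instruction-at (at-! eq)         = _ , eq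
  instruction-at (at-jump eq _)    = _ , eq
  instruction-at (at-plain eq _ _) = _ , eq
  instruction-at (at-+test eq _ _) = _ , eq
  instruction-at (at--test eq _ _) = _ , eq

  module _ {X : InstructionSequence} {Ok : BasicInstruction → Set} where

    -- Jumps lead forward, so the position `p` of the run is never behind the position `i` of the
    -- pass. The recursion is on the instructions `us` from `i` on, which are skipped until `p` is
    -- reached; they cannot run out before, as a terminating run has an instruction at `p`.
    simulates : ∀ {i p s s′ S} us x → (∀ k → us ‼ k ≡ List⁺.toList X ‼ (i + k)) → i ≤ p →
                Terminates X Ok p s s′ → Holds i (only p) s S →
                execute (program i us) x S (register out) ≡ s′ out
    simulates {i} {p} [] x rest i≤p t h with instruction-at t
    ... | u , eq = contradiction
      (trans (sym (‼-[] (p ∸ i))) (trans (rest (p ∸ i)) (trans (cong (List⁺.toList X ‼_) (m+[n∸m]≡n i≤p)) eq))) λ ()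
    simulates {i} {p} {s} {s′} {S} (u ∷ us) x rest i≤p t h
      rewrite execute-++ (assignments i u) (program (suc i) us) x S with i ≟ p
    ... | no i≢p  = simulates us x rest′ (≤∧≢⇒< i≤p i≢p) t
                      (holds-≗ (n≤1+n i) (λ _ → refl) (skip x u (dec-false (i ≟ p) i≢p) h))
      where
      rest′ : ∀ k → us ‼ k ≡ List⁺.toList X ‼ (suc i + k)
      rest′ k = trans (rest (suc k)) (cong (List⁺.toList X ‼_) (+-suc i k))
    ... | yes refl = execute-here t
      where
      rest′ : ∀ k → us ‼ k ≡ List⁺.toList X ‼ (suc i + k)
      rest′ k = trans (rest (suc k)) (cong (List⁺.toList X ‼_) (+-suc i k))

      head≡ : ∀ {u′} → List⁺.toList X ‼ i ≡ just u′ → u ≡ u′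
      head≡ eq = just-injective (trans (rest 0) (trans (cong (List⁺.toList X ‼_) (+-identityʳ i)) eq))

      execute-here : Terminates X Ok i s s′ → execute (program (suc i) us) x (execute (assignments i u) x S) (register out) ≡ s′ out
      execute-here (at-! eq) with refl ← head≡ eq =
        halted us x (holds-≗ (n≤1+n i) (λ {j} i<j → dec-false (j ≟ i) (≢-sym (<⇒≢ i<j))) h)
      execute-here (at-jump {l = l} eq t) with refl ← head≡ eq =
        simulates us x rest′ (i<i+suc l) t
          -- A jump is treated as a step with a dummy basic instruction: `out ∙ get` generates no
          -- update and leaves the registers unchanged.
          (step-goto x l (signal (active i)) (out ∙ get) (trans (control h ≤-refl) (only-here i)) h)
      execute-here (at-plain {a = a} eq _ t) with refl ← head≡ eq =
        simulates us x rest′ (i<i+suc 0) t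
          (step-goto x 0 (signal (active i)) a (trans (control h ≤-refl) (only-here i)) h)
      execute-here (at-+test {a = a} eq _ t) with refl ← head≡ eq =
        simulates us x rest′ (target (reply a s)) t (step-test x 0 1 a h)
        where
        target : ∀ r → i < (if r then i + 1 else i + 2)
        target true  = i<i+suc 0
        target false = i<i+suc 1
      execute-here (at--test {a = a} eq _ t) with refl ← head≡ eq =
        simulates us x rest′ (target (reply a s)) t (step-test x 1 0 a h)
        where
        target : ∀ r → i < (if r then i + 2 else i + 1)
        target true  = i<i+suc 1
        target false = i<i+suc 0

-- A circuit for 3SAT from an instruction sequence for 3SATᶜ

even : ℕ → Bool
even zero          = true
even (suc zero)    = false
even (suc (suc n)) = even n

evenLength-toList : ∀ {n} (x : Vec Bool n) → evenLength (toList x) ≡ even n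
evenLength-toList []          = refl
evenLength-toList (_ ∷ [])    = refl
evenLength-toList (_ ∷ _ ∷ x) = evenLength-toList x

length-symbolsOf : ∀ {n} (x : Vec Bool n) → length (symbolsOf x) ≤ n
length-symbolsOf []          = z≤n
length-symbolsOf (_ ∷ [])    = z≤n
length-symbolsOf (_ ∷ _ ∷ x) = s≤s (m≤n⇒m≤1+n (length-symbolsOf x))

toList-‼ : ∀ {m} (v : Vec Bool m) {j} (j<m : j < m) → toList v ‼ j ≡ just (Vec.lookup v (fromℕ< j<m))
toList-‼ (b ∷ v) {zero}  _         = refl
toList-‼ (b ∷ v) {suc j} (s≤s j<m) = toList-‼ v j<m

toList-‼-beyond : ∀ {m} (v : Vec Bool m) {j} → m ≤ j → toList v ‼ j ≡ nothing
toList-‼-beyond []      {zero}  _         = refl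
toList-‼-beyond []      {suc j} _         = refl
toList-‼-beyond (b ∷ v) {suc j} (s≤s m≤j) = toList-‼-beyond v m≤j

syntaxCost selectorCost scanCost : ℕ → ℕ
syntaxCost n   = suc n * SuffixRecursion.layerCost (syntaxRecursion n)
scanCost n     = n * (n * 20 + 1 + 1) + 1 + 2
selectorCost n = suc n * (4 * suc (caseCost (scanCost n)))

bounded-suc : ∀ {f} → Bounded f → Bounded (λ n → suc (f n))
bounded-suc = bounded-+ (bounded-const 1)

bounded-syntaxCost : Bounded syntaxCost
bounded-syntaxCost = bounded-* {f = suc} {g = λ n → SuffixRecursion.layerCost (syntaxRecursion n)}
  (bounded-suc bounded-id) (bounded-const (SuffixRecursion.layerCost (syntaxRecursion 0)))

bounded-caseCost : ∀ {f} → Bounded f → Bounded (λ n → caseCost (f n))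
bounded-caseCost b = bounded-+ (bounded-* c₂ (bounded-+ (bounded-* c₂ b) (bounded-const 4))) (bounded-const 4)
  where c₂ = bounded-const 2

bounded-selectorCost : Bounded selectorCost
bounded-selectorCost = bounded-* {f = suc} {g = λ n → 4 * suc (caseCost (scanCost n))}
  (bounded-suc bounded-id) (bounded-* (bounded-const 4) (bounded-suc (bounded-caseCost bounded-scanCost)))
  where
  bounded-scanCost : Bounded scanCost
  bounded-scanCost = bounded-+ (bounded-+ (bounded-* bounded-id
    (bounded-+ (bounded-+ (bounded-* bounded-id (bounded-const 20)) (bounded-const 1)) (bounded-const 1)))
    (bounded-const 1)) (bounded-const 2)

module _ {A : Set} {m : ℕ} (f : Fin m → A) where

  entry : ∀ {j} → Dec (j < m) → Maybe A
  entry (yes j<m) = just (f (fromℕ< j<m))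
  entry (no _)    = nothing

  entry-toℕ : ∀ i {j} → j ≡ toℕ i → (j<?m : Dec (j < m)) → entry j<?m ≡ just (f i)
  entry-toℕ i refl (yes i<m) = cong (just ∘ f) (fromℕ<-toℕ i i<m)
  entry-toℕ i refl (no i≮m)  = contradiction (toℕ<n i) i≮m

module _ (E : ClauseEnumeration) where
  open ClauseEnumeration E

  module Decider (n m : ℕ) (n≤k : n ≤ level m)
                 (X : InstructionSequence) (computes : Computes X (3SATᶜ E m)) where

    k    = level m
    d≤   = proj₁ (level-spec m)

    selector : Fin m → Signal n
    selector j x =
      maybe′ (λ c → scanClauses (matches n c (symbolsOf x)) atClause (symbolsOf x)) false (entry (clause α k) (toℕ j <? d k))

    selectors : Vec Bool n → Vec Bool m
    selectors x = Vec.tabulate (λ j → selector j x)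

    tracks : Track → Signal n
    tracks (active j)   x = only 0 j
    tracks (register f) x = initialRegisters (selectors x) f

    simulation : Signal n
    simulation x = execute (program 0 (List⁺.toList X)) x (λ t → tracks t x) (register out)

    decides : Signal n
    -- `symbols` drops an odd last bit, so the parity of the length is tested separately; it is a
    -- constant of the circuit.
    decides x = accepts clauseStart (symbolsOf x) ∧ (simulation x ∧ even n)

    simulation-correct : ∀ x → simulation x ≡ 3SATᶜ E m (selectors x)
    simulation-correct x =
      let (s , t , eq) = computes (selectors x)
      in trans (simulates (List⁺.toList X) x (λ _ → refl) z≤n t (holds (λ _ → refl) (λ _ → refl))) eq

    selectors-correct : ∀ x φ → symbolsOf x ≡ formulaSymbols φ → ∀ i →
      Vec.lookup (selectors x) (inject≤ i d≤) ≡
      any (all (matched (matches n (clause α k i) (formulaSymbols φ)))) φ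
    selectors-correct x φ eq i = begin
      Vec.lookup (selectors x) (inject≤ i d≤)
        ≡⟨ lookup∘tabulate _ (inject≤ i d≤) ⟩
      maybe′ scan false (entry (clause α k) (toℕ (inject≤ i d≤) <? d k))
        ≡⟨ cong (maybe′ scan false) (entry-toℕ (clause α k) i (toℕ-inject≤ i d≤) (toℕ (inject≤ i d≤) <? d k)) ⟩
      scan (clause α k i)
        ≡⟨ cong (λ s → scanClauses (matches n (clause α k i) s) atClause s) eq ⟩
      scanClauses (matches n (clause α k i) (formulaSymbols φ)) atClause (formulaSymbols φ)
        ≡⟨ scan-formula _ φ ⟩
      _ ∎
      where
      open ≡-Reasoning
      scan : Clause → Bool
      scan c = scanClauses (matches n c (symbolsOf x)) atClause (symbolsOf x)

    decides-correct : ∀ x → decides x ≡ true ⇔ 3SAT (toList x)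
    decides-correct x = mk⇔ sound complete
      where
      short : ∀ φ → symbolsOf x ≡ formulaSymbols φ → length (formulaSymbols φ) ≤ n
      short φ eq = subst (λ s → length s ≤ n) eq (length-symbolsOf x)

      sound : decides x ≡ true → 3SAT (toList x)
      sound eq = φ , 3cnf , satisfiable , encoded
        where
        reads = accepts⇒Reads clauseStart (symbolsOf x) (Bool.∧-conicalˡ _ _ eq)
        φ     = proj₁ reads
        3cnf  = proj₁ (proj₂ reads)
        read  = proj₂ (proj₂ reads)
        rest : simulation x ∧ even n ≡ true
        rest = Bool.∧-conicalʳ (accepts clauseStart (symbolsOf x)) _ eq
        satisfiable : Satisfiable φ
        satisfiable = satisfiable-original E m (selectors x) n φ 3cnf n≤k (short φ (sym read))
          (selectors-correct x φ (sym read))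
          (does-sound (satisfiable? (selected E m (selectors x)))
            (trans (sym (simulation-correct x)) (Bool.∧-conicalˡ _ _ rest)))
        encoded : encode φ ≡ toList x
        encoded = trans (encode≡ φ) (trans (cong symbolCodes read)
          (symbolCodes-symbols (toList x) (trans (evenLength-toList x) (Bool.∧-conicalʳ (simulation x) _ rest))))

      complete : 3SAT (toList x) → decides x ≡ true
      complete (φ , 3cnf , satisfiable , encoded) = cong₂ _∧_
        (trans (cong (accepts clauseStart) read) (accepts-formula φ 3cnf))
        (cong₂ _∧_
          (trans (simulation-correct x) (dec-true (satisfiable? (selected E m (selectors x)))
            (satisfiable-selected E m (selectors x) n φ 3cnf n≤k (short φ read) (selectors-correct x φ read) satisfiable)))
          (trans (sym (evenLength-toList x))
            (trans (cong evenLength (trans (sym encoded) (encode≡ φ))) (evenLength-symbolCodes (formulaSymbols φ)))))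
        where
        read : symbolsOf x ≡ formulaSymbols φ
        read = trans (cong symbols (sym encoded)) (symbols-encode φ)

    constant : Bool → Signal n
    constant b x = b

    reach-constant : ∀ N b → Reach N 1 (_∋ constant b)
    reach-constant N b = realize {S = λ (i : ⊥) x → false} N (λ ()) (const b)

    decisionCost : ℕ
    -- The ones are the two constants, and the final 3 is the conjunction together with the constant
    -- parity.
    decisionCost = 1 + (1 + (syntaxCost n + (m * selectorCost n + (List⁺.length X * 12 + 3))))

    module _ {N : Net n} (consts : N ∋ᵃ constant) where

      reach-syntax : Reach N (syntaxCost n) (_∋ λ x → accepts clauseStart (symbolsOf x))
      reach-syntax = reach-map (λ h → h clauseStart)
        (SuffixRecursion.reach-layer (syntaxRecursion n) N {λ _ → constant false} (λ _ → consts false) n 0 (m≤m+n n 0))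

      reach-scan : ∀ c? → Reach N (selectorCost n)
        (_∋ λ x → maybe′ (λ c → scanClauses (matches n c (symbolsOf x)) atClause (symbolsOf x)) false c?)
      reach-scan (just c) = reach-map (λ h → h atClause)
        (SuffixRecursion.reach-layer (scanRecursion n c) N {λ _ → constant false} (λ _ → consts false) n 0 (m≤m+n n 0))
      reach-scan nothing  = weaken z≤n (stop (consts false))

      reach-selector : ∀ j → Reach N (selectorCost n) (_∋ selector j)
      reach-selector j = reach-scan (entry (clause α k) (toℕ j <? d k))

      ∋-tracks : (∀ j → N ∋ selector j) → N ∋ᵃ tracks
      ∋-tracks sel (active j)         = consts (only 0 j)
      ∋-tracks sel (register (aux i)) = consts false
      ∋-tracks sel (register out)     = consts false
      ∋-tracks sel (register (inp j)) with j <? m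
      ... | yes j<d = ∋-resp (λ x → sym (trans (cong (fromMaybe false) (toList-‼ (selectors x) j<d))
                                               (lookup∘tabulate _ (fromℕ< j<d)))) (sel (fromℕ< j<d))
      ... | no j≮d  = ∋-resp (λ x → sym (cong (fromMaybe false) (toList-‼-beyond (selectors x) (≮⇒≥ j≮d)))) (consts false)

    reach-decides : Reach (net []) decisionCost (_∋ decides)
    reach-decides =
      reach-constant (net []) true ⟫= λ {N₁} _ t →
      reach-constant N₁ false ⟫= λ {N₂} e₂ f →
      let consts : N₂ ∋ᵃ constant
          consts = λ { true → e₂ t ; false → f } in
      reach-syntax consts ⟫= λ {N₃} e₃ acc →
      weaken (≤-reflexive (cong (_* selectorCost n) (length-tabulate {n = m} id)))
        (reach-all (allFin m) λ e → reach-selector (λ b → e (e₃ (consts b)))) ⟫= λ {N₄} e₄ sel →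
      weaken (cost-program 0 (List⁺.toList X))
        (reach-exec _≟ᵗ_ N₄ (∋-tracks (λ b → e₄ (e₃ (consts b))) (λ j → sel (∈-allFin j)))
                    (program 0 (List⁺.toList X))) ⟫= λ {N₅} e₅ sim →
      realize {S = λ { true → λ x → accepts clauseStart (symbolsOf x) ; false → simulation }} N₅
        (λ { true → e₅ (e₄ acc) ; false → sim (register out) })
        (signal true & (signal false & const (even n)))

  3SATᶜ∈P*lis⇒3SAT∈P/poly : P*lis (3SATᶜ E) → P/poly 3SAT
  3SATᶜ∈P*lis⇒3SAT∈P/poly (h , family) = circuit , proj₁ bounded , λ n →
    ≤-trans (size≤ n) (proj₂ bounded n) , λ x →
      let module D = Decider n (d n) (k≤level[d[k]] n) (X n) (computes n)
          open Equivalence (D.decides-correct x)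
      in mk⇔ (λ eq → to (trans (sym (correct n x)) eq)) (λ sat → trans (correct n x) (from sat))
    where
    X : ℕ → InstructionSequence
    X n = proj₁ (family (d n))

    computes : ∀ n → Computes (X n) (3SATᶜ E (d n))
    computes n = proj₁ (proj₂ (proj₂ (family (d n))))

    reached : ∀ n → Reach (net []) (Decider.decisionCost n (d n) (k≤level[d[k]] n) (X n) (computes n)) (_∋ Decider.decides n (d n) (k≤level[d[k]] n) (X n) (computes n))
    reached n = Decider.reach-decides n (d n) (k≤level[d[k]] n) (X n) (computes n)

    circuit : ∀ n → Circuit n
    circuit n = record
      { gates  = Net.gates (Reach.target (reached n))
      ; output = _∋_.wire (Reach.holds (reached n)) }

    correct : ∀ n x → evaluate (circuit n) x ≡ Decider.decides n (d n) (k≤level[d[k]] n) (X n) (computes n) x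
    correct n = _∋_.carries (Reach.holds (reached n))

    bound : ℕ → ℕ
    bound n = 1 + (1 + (syntaxCost n + (d n * selectorCost n + (⟦ h ⟧ (d n) * 12 + 3))))

    size≤ : ∀ n → Circuit.size (circuit n) ≤ bound n
    size≤ n = ≤-trans (Reach.growth (reached n))
      (+-monoʳ-≤ 2 (+-monoʳ-≤ (syntaxCost n) (+-monoʳ-≤ (d n * selectorCost n)
        (+-monoˡ-≤ 3 (*-monoˡ-≤ 12 (proj₂ (proj₂ (proj₂ (family (d n))))))))))

    bounded : Bounded bound
    bounded = bounded-suc (bounded-suc (bounded-+ {f = syntaxCost} bounded-syntaxCost
      (bounded-+ (bounded-* bounded-d bounded-selectorCost)
        (bounded-+ (bounded-* (bounded-∘ h bounded-d) (bounded-const 12)) (bounded-const 3)))))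

-- Encodings whose length does not depend on the selection

-- Exactly three literals, so that a clause and its filler have the same number of signs and commas
-- and only the widths of the numerals remain to be adjusted.
pad : Clause → Clause
pad (a ∷ [])     = a ∷ a ∷ a ∷ []
pad (a ∷ b ∷ []) = a ∷ b ∷ b ∷ []
pad c            = c

pad-3 : ∀ c → OneToThree c → length (pad c) ≡ 3
pad-3 []                  (() , _)
pad-3 (_ ∷ [])            _ = refl
pad-3 (_ ∷ _ ∷ [])        _ = refl
pad-3 (_ ∷ _ ∷ _ ∷ [])    _ = refl
pad-3 (_ ∷ _ ∷ _ ∷ _ ∷ _) (_ , s≤s (s≤s (s≤s ())))

All-pad : ∀ {P : Literal → Set} c → All P c → All P (pad c)
All-pad []                  ps           = ps
All-pad (_ ∷ [])            (p ∷ [])     = p ∷ p ∷ p ∷ []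
All-pad (_ ∷ _ ∷ [])        (p ∷ q ∷ []) = p ∷ q ∷ q ∷ []
All-pad (_ ∷ _ ∷ _ ∷ [])    ps           = ps
All-pad (_ ∷ _ ∷ _ ∷ _ ∷ _) ps           = ps

Any-pad⁺ : ∀ {P : Literal → Set} c → Any P c → Any P (pad c)
Any-pad⁺ (_ ∷ [])            (here p)         = here p
Any-pad⁺ (_ ∷ _ ∷ [])        (here p)         = here p
Any-pad⁺ (_ ∷ _ ∷ [])        (there (here p)) = there (here p)
Any-pad⁺ (_ ∷ _ ∷ _ ∷ [])    p                = p
Any-pad⁺ (_ ∷ _ ∷ _ ∷ _ ∷ _) p                = p

Any-pad⁻ : ∀ {P : Literal → Set} c → Any P (pad c) → Any P c
Any-pad⁻ (_ ∷ [])            (here p)                 = here p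
Any-pad⁻ (_ ∷ [])            (there (here p))         = here p
Any-pad⁻ (_ ∷ [])            (there (there (here p))) = here p
Any-pad⁻ (_ ∷ _ ∷ [])        (here p)                 = here p
Any-pad⁻ (_ ∷ _ ∷ [])        (there (here p))         = there (here p)
Any-pad⁻ (_ ∷ _ ∷ [])        (there (there (here p))) = there (here p)
Any-pad⁻ (_ ∷ _ ∷ _ ∷ [])    p                        = p
Any-pad⁻ (_ ∷ _ ∷ _ ∷ _ ∷ _) p                        = p

width : Literal → ℕ
width l = length (binary (suc (var l)))

totalWidth : Clause → ℕ
totalWidth c = sum (map width c)

length-symbolCodes : ∀ us → length (symbolCodes us) ≡ 2 * length us
length-symbolCodes []       = refl
length-symbolCodes (σ ∷ us) = begin
  length (symbolCode σ ++ symbolCodes us)          ≡⟨ length-++ (symbolCode σ) ⟩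
  length (symbolCode σ) + length (symbolCodes us)  ≡⟨ cong₂ _+_ (length-symbolCode σ) (length-symbolCodes us) ⟩
  2 + 2 * length us                                ≡⟨ *-suc 2 (length us) ⟨
  2 * suc (length us)                              ∎
  where
  open ≡-Reasoning
  length-symbolCode : ∀ σ → length (symbolCode σ) ≡ 2
  length-symbolCode (bit _)   = refl
  length-symbolCode comma     = refl
  length-symbolCode semicolon = refl

length-clauseSymbols : ∀ c → length (clauseSymbols c) ≡ totalWidth c + 2 * length c + 1
length-clauseSymbols []      = refl
length-clauseSymbols (l ∷ c) = begin
  length (clauseSymbols (l ∷ c))
    ≡⟨ cong length (sym (++-identityʳ (clauseSymbols (l ∷ c)))) ⟩
  length (clauseSymbols (l ∷ c) ++ [])
    ≡⟨ cong length (clauseSymbols-∷ l c []) ⟩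
  suc (length (map bit (binary (suc (var l))) ++ comma ∷ clauseSymbols c ++ []))
    ≡⟨ cong suc (length-++ (map Symbol.bit (binary (suc (var l))))) ⟩
  suc (length (map Symbol.bit (binary (suc (var l)))) + suc (length (clauseSymbols c ++ [])))
    ≡⟨ cong₂ (λ a b → suc (a + suc b)) (length-map bit (binary (suc (var l))))
             (trans (cong length (++-identityʳ (clauseSymbols c))) (length-clauseSymbols c)) ⟩
  suc (width l + suc (totalWidth c + 2 * length c + 1))
    ≡⟨ regroup (width l) (totalWidth c) (length c) ⟩
  width l + totalWidth c + 2 * suc (length c) + 1 ∎
  where
  open ≡-Reasoning
  regroup : ∀ w t n → suc (w + suc (t + 2 * n + 1)) ≡ w + t + 2 * suc n + 1
  regroup = solve-∀

length-encodeClause : ∀ c → length (encodeClause c) ≡ 2 * (totalWidth c + 2 * length c + 1)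
length-encodeClause c = trans (length-symbolCodes (clauseSymbols c)) (cong (2 *_) (length-clauseSymbols c))

-- A tautology that takes as many bits as the padded clause.

filler : Clause → Clause
filler c = pos 0 ∷ neg 0 ∷ pos (proj₁ (binary-ofLength (totalWidth (pad c) ∸ 3))) ∷ []

length≤totalWidth : ∀ c → length c ≤ totalWidth c
length≤totalWidth []      = z≤n
length≤totalWidth (l ∷ c) = +-mono-≤ 1≤width (length≤totalWidth c)
  where
  1≤width : 1 ≤ width l
  1≤width = let (b , bs , eq) = binary-suc (var l) in subst (λ bs → 1 ≤ length bs) (sym eq) (s≤s z≤n)

-- The numerals of `pos 0` and `neg 0` have one digit each, and the third absorbs the rest. The
-- subtraction of 3 is exact because each of the three padded literals has at least one digit.
totalWidth-filler : ∀ c → OneToThree c → totalWidth (filler c) ≡ totalWidth (pad c)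
totalWidth-filler c p = begin
  1 + (1 + (length (binary (suc (proj₁ y))) + 0))  ≡⟨ cong (λ w → 2 + (w + 0)) (proj₂ y) ⟩
  3 + (totalWidth (pad c) ∸ 3 + 0)                 ≡⟨ cong (3 +_) (+-identityʳ _) ⟩
  3 + (totalWidth (pad c) ∸ 3)                     ≡⟨ m+[n∸m]≡n (subst (_≤ totalWidth (pad c)) (pad-3 c p) (length≤totalWidth (pad c))) ⟩
  totalWidth (pad c)                               ∎
  where
  open ≡-Reasoning
  y = binary-ofLength (totalWidth (pad c) ∸ 3)

length-filler : ∀ c → OneToThree c → length (encodeClause (pad c)) ≡ length (encodeClause (filler c))
length-filler c p = begin
  length (encodeClause (pad c))
    ≡⟨ length-encodeClause (pad c) ⟩
  2 * (totalWidth (pad c) + 2 * length (pad c) + 1)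
    ≡⟨ cong₂ (λ w l → 2 * (w + 2 * l + 1)) (sym (totalWidth-filler c p)) (pad-3 c p) ⟩
  2 * (totalWidth (filler c) + 2 * 3 + 1)
    ≡⟨ length-encodeClause (filler c) ⟨
  length (encodeClause (filler c)) ∎
  where open ≡-Reasoning

filler-true : ∀ σ c → Any (λ l → value σ l ≡ true) (filler c)
filler-true σ c with σ 0 in eq
... | true  = here eq
... | false = there (here (cong not eq))

totalWidth-≤ : ∀ {k} c → All (λ l → var l < k) c → totalWidth c ≤ length c * k
totalWidth-≤ []      []       = z≤n
totalWidth-≤ (l ∷ c) (p ∷ ps) = +-mono-≤ (≤-trans (length-binary (suc (var l))) p) (totalWidth-≤ c ps)

-- Three numerals of at most `k` digits each, three signs, three commas and a semicolon, at two bits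
-- per symbol.
length-pad : ∀ {k} c → OneToThree c → All (λ l → var l < k) c → length (encodeClause (pad c)) ≤ 2 * (3 * k + 7)
length-pad {k} c p r = begin
  length (encodeClause (pad c))                      ≡⟨ length-encodeClause (pad c) ⟩
  2 * (totalWidth (pad c) + 2 * length (pad c) + 1)  ≤⟨ *-monoʳ-≤ 2 (+-monoˡ-≤ 1 (+-monoˡ-≤ (2 * length (pad c)) (totalWidth-≤ (pad c) (All-pad c r)))) ⟩
  2 * (length (pad c) * k + 2 * length (pad c) + 1)  ≡⟨ cong (λ l → 2 * (l * k + 2 * l + 1)) (pad-3 c p) ⟩
  2 * (3 * k + 6 + 1)                                ≡⟨ cong (2 *_) (+-assoc (3 * k) 6 1) ⟩
  2 * (3 * k + 7)                                    ∎
  where open ≤-Reasoning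

zip-choose : ∀ s (xs ys : List Bool) → length xs ≡ length ys →
  map (λ (t , f) → if s then t else f) (zip xs ys) ≡ (if s then xs else ys)
zip-choose true  []       []       eq = refl
zip-choose false []       []       eq = refl
zip-choose true  (x ∷ xs) (y ∷ ys) eq = cong (x ∷_) (zip-choose true xs ys (suc-injective eq))
zip-choose false (x ∷ xs) (y ∷ ys) eq = cong (y ∷_) (zip-choose false xs ys (suc-injective eq))

length-concatMap-≤ : ∀ {A B : Set} (f : A → List B) {m} → (∀ a → length (f a) ≤ m) →
                     ∀ as → length (concatMap f as) ≤ length as * m
length-concatMap-≤ f p []       = z≤n
length-concatMap-≤ f p (a ∷ as) = ≤-trans (≤-reflexive (length-++ (f a))) (+-mono-≤ (p a) (length-concatMap-≤ f p as))

-- One bit of an encoding: the index of its clause, the bit if that clause is selected, and the bit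
-- if it is not.
Choice : ℕ → Set
Choice m = Fin m × Bool × Bool

choose : ∀ {m} → (Fin m → Bool) → Choice m → Bool
choose s (i , t , f) = if s i then t else f

module _ {m : ℕ} (c : Fin m → Clause) (1-3 : ∀ i → OneToThree (c i)) where

  block : Fin m → List (Choice m)
  block i = map (i ,_) (zip (encodeClause (pad (c i))) (encodeClause (filler (c i))))

  template : List (Choice m)
  template = concatMap block (allFin m)

  choice : (Fin m → Bool) → Fin m → Clause
  choice s i = if s i then pad (c i) else filler (c i)

  instantiate : (Fin m → Bool) → CNF
  instantiate s = map (choice s) (allFin m)

  template-encodes : ∀ s → map (choose s) template ≡ encode (instantiate s)
  template-encodes s = begin
    map (choose s) (concatMap block (allFin m))      ≡⟨ map-concatMap (choose s) block (allFin m) ⟩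
    concatMap (map (choose s) ∘ block) (allFin m)    ≡⟨ concatMap-cong chosen (allFin m) ⟩
    concatMap (encodeClause ∘ choice s) (allFin m)   ≡⟨ concatMap-map encodeClause (choice s) (allFin m) ⟨
    encode (instantiate s)                           ∎
    where
    open ≡-Reasoning
    encode-if : ∀ b {e e′} → (if b then encodeClause e else encodeClause e′) ≡ encodeClause (if b then e else e′)
    encode-if true  = refl
    encode-if false = refl
    chosen : ∀ i → map (choose s) (block i) ≡ encodeClause (choice s i)
    chosen i = trans (sym (map-∘ (zip (encodeClause (pad (c i))) (encodeClause (filler (c i))))))
      (trans (zip-choose (s i) _ _ (length-filler (c i) (1-3 i))) (encode-if (s i)))

  instantiate-3CNF : ∀ s → Is3CNF (instantiate s)
  instantiate-3CNF s = All.tabulate λ e∈ → let (i , _ , eq) = ∈-map⁻ (choice s) e∈ in subst OneToThree (sym eq) (three i)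
    where
    three : ∀ i → OneToThree (choice s i)
    three i with s i
    ... | true  = subst (λ l → 1 ≤ l × l ≤ 3) (sym (pad-3 (c i) (1-3 i))) (s≤s z≤n , ≤-refl)
    ... | false = s≤s z≤n , ≤-refl

  instantiate-⊨⁺ : ∀ s σ → (∀ i → s i ≡ true → Any (λ l → value σ l ≡ true) (c i)) → σ ⊨ instantiate s
  instantiate-⊨⁺ s σ h = All.tabulate λ e∈ → let (i , _ , eq) = ∈-map⁻ (choice s) e∈ in
    subst (Any (λ l → value σ l ≡ true)) (sym eq) (satisfied i)
    where
    satisfied : ∀ i → Any (λ l → value σ l ≡ true) (choice s i)
    satisfied i with s i in eq
    ... | true  = Any-pad⁺ (c i) (h i eq)
    ... | false = filler-true σ (c i)

  instantiate-⊨⁻ : ∀ s σ → σ ⊨ instantiate s → ∀ i → s i ≡ true → Any (λ l → value σ l ≡ true) (c i)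
  instantiate-⊨⁻ s σ h i eq = Any-pad⁻ (c i)
    (subst (λ b → Any (λ l → value σ l ≡ true) (if b then pad (c i) else filler (c i))) eq
           (All.lookup h (∈-map⁺ (choice s) (∈-allFin i))))

  length-template : ∀ {k} → (∀ i → All (λ l → var l < k) (c i)) → length template ≤ m * (2 * (3 * k + 7))
  length-template {k} r = ≤-trans (length-concatMap-≤ block bound (allFin m))
    (≤-reflexive (cong (_* (2 * (3 * k + 7))) (length-tabulate {n = m} id)))
    where
    bound : ∀ i → length (block i) ≤ 2 * (3 * k + 7)
    bound i = begin
      length (block i)       ≡⟨ length-map (i ,_) (zip xs ys) ⟩
      length (zip xs ys)     ≡⟨ length-zipWith _,_ xs ys ⟩
      length xs ⊓ length ys  ≤⟨ m⊓n≤m (length xs) (length ys) ⟩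
      length xs              ≤⟨ length-pad (c i) (1-3 i) (r i) ⟩
      2 * (3 * k + 7)        ∎
      where
      open ≤-Reasoning
      xs = encodeClause (pad (c i))
      ys = encodeClause (filler (c i))

module _ (E : ClauseEnumeration) where
  open ClauseEnumeration E

  module Encoding (n : ℕ) where

    private k = level n

    1-3 : ∀ i → OneToThree (clause α k i)
    1-3 i = LiteralSet.oneToThree (Bijection.to (α k) i)

    choices : List (Choice (d k))
    choices = template (clause α k) 1-3

    isSelected : Vec Bool n → Fin (d k) → Bool
    isSelected b i = Vec.lookup b (inject≤ i (proj₁ (level-spec n)))

    encoding : Vec Bool n → Vec Bool (length choices)
    encoding b = Vec.map (choose (isSelected b)) (fromList choices)

    formula : Vec Bool n → CNF
    formula b = instantiate (clause α k) 1-3 (isSelected b)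

    toList-encoding : ∀ b → toList (encoding b) ≡ encode (formula b)
    toList-encoding b = trans (toList-map (choose (isSelected b)) (fromList choices))
      (trans (cong (map (choose (isSelected b))) (toList∘fromList choices)) (template-encodes (clause α k) 1-3 (isSelected b)))

    Satisfies : Assignment → Clause → Set
    Satisfies σ = Any (λ l → value σ l ≡ true)

    formula⇒selected : ∀ b σ → σ ⊨ formula b → σ ⊨ selected E n b
    formula⇒selected b σ h = All.tabulate satisfies
      where
      satisfies : ∀ {c} → c ∈ selected E n b → Satisfies σ c
      satisfies c∈ = let (i , eq , sel) = ∈-selected⁻ E n b c∈ in
        subst (Satisfies σ) (sym eq) (instantiate-⊨⁻ (clause α k) 1-3 (isSelected b) σ h i sel)

    selected⇒formula : ∀ b σ → σ ⊨ selected E n b → σ ⊨ formula b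
    selected⇒formula b σ h = instantiate-⊨⁺ (clause α k) 1-3 (isSelected b) σ
      λ i sel → All.lookup h (∈-selected⁺ E n b i sel)

    encoding-sound : ∀ b → 3SAT (toList (encoding b)) → Satisfiable (selected E n b)
    encoding-sound b sat = let (σ , h) = satisfiable-encode (formula b) (subst 3SAT (toList-encoding b) sat) in
      σ , formula⇒selected b σ h

    encoding-complete : ∀ b → Satisfiable (selected E n b) → 3SAT (toList (encoding b))
    encoding-complete b (σ , h) = subst 3SAT (sym (toList-encoding b))
      (formula b , instantiate-3CNF (clause α k) 1-3 (isSelected b) , (σ , selected⇒formula b σ h) , refl)

    length-choices : length choices ≤ n * (2 * (3 * n + 7))
    length-choices = ≤-trans
      (length-template (clause α k) 1-3 (λ i → LiteralSet.inRange (Bijection.to (α k) i)))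
      (*-mono-≤ (proj₁ (level-spec n)) (*-monoʳ-≤ 2 (+-monoˡ-≤ 7 (*-monoʳ-≤ 3 (level-≤ n)))))

-- Instruction sequences from circuits

register-get : ∀ {m} (v : Vec Bool m) (i : Fin m) → fromMaybe false (toList v ‼ toℕ i) ≡ Vec.lookup v i
register-get (b ∷ v) zero    = refl
register-get (b ∷ v) (suc i) = register-get v i

-- Auxiliary registers and `out` start as `false`, so a value is stored in an untouched register by
-- setting it only when the value is true.
setIf : Bool → Focus → Registers → Registers
setIf v f s = if v then effect (f ∙ set true) s else s

-- Execution of a block P that occupies the positions from i on, all of
-- whose jumps stay inside P or lead to its end.

module _ (X : InstructionSequence) (n : ℕ) where

  Located : ℕ → List Instruction → Set
  Located i []      = ⊤
  Located i (u ∷ P) = List⁺.toList X ‼ i ≡ just u × Located (suc i) P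

  Ends : ℕ → Registers → Registers → Set
  Ends = Terminates X (InputsBelow n)

  located-++ : ∀ i P {Q} → Located i (P ++ Q) → Located i P × Located (length P + i) Q
  located-++ i []      l       = tt , l
  located-++ i (u ∷ P) {Q} (e , l) = let (p , q) = located-++ (suc i) P l in
    (e , p) , subst (λ j → Located j Q) (+-suc (length P) i) q

  module _ {i : ℕ} {a : BasicInstruction} {s s′ : Registers} where

    do-plain : List⁺.toList X ‼ i ≡ just (plain a) → InputsBelow n a → Ends (suc i) (effect a s) s′ → Ends i s s′
    do-plain e ok t = at-plain e ok (subst (λ j → Ends j (effect a s) s′) (+-comm 1 i) t)

    do-+test : List⁺.toList X ‼ i ≡ just (+test a) → InputsBelow n a →
               Ends (if reply a s then suc i else suc (suc i)) (effect a s) s′ → Ends i s s′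
    do-+test e ok t = at-+test e ok
      (subst (λ j → Ends j (effect a s) s′) (cong₂ (if reply a s then_else_) (+-comm 1 i) (+-comm 2 i)) t)

    do--test : List⁺.toList X ‼ i ≡ just (-test a) → InputsBelow n a →
               Ends (if reply a s then suc (suc i) else suc i) (effect a s) s′ → Ends i s s′
    do--test e ok t = at--test e ok
      (subst (λ j → Ends j (effect a s) s′) (cong₂ (if reply a s then_else_) (+-comm 2 i) (+-comm 1 i)) t)

  do-jump : ∀ {i l s s′} → List⁺.toList X ‼ i ≡ just (jump (suc l)) → Ends (suc l + i) s s′ → Ends i s s′
  do-jump {i} {l} {s} {s′} e t = at-jump e (subst (λ j → Ends j s s′) (+-comm (suc l) i) t)

  -- `Terminates` describes runs up to `!` only, so a block is specified in continuation style:
  -- termination from its end gives termination from its start. The start `i` is arbitrary because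
  -- jumps are relative.
  Runs : List Instruction → Registers → Registers → Set
  Runs P s s₁ = ∀ {i s′} → Located i P → Ends (length P + i) s₁ s′ → Ends i s s′

  runs-[] : ∀ {s} → Runs [] s s
  runs-[] _ t = t

  runs-++ : ∀ {P Q s s₁ s₂} → Runs P s s₁ → Runs Q s₁ s₂ → Runs (P ++ Q) s s₂
  runs-++ {P} {Q} {s₂ = s₂} r r′ {i} {s′} l t =
    let (p , q) = located-++ i P l in
    r p (r′ q (subst (λ j → Ends j s₂ s′) (trans (cong (_+ i) (trans (length-++ P) (+-comm (length P) (length Q)))) (+-assoc (length Q) (length P) i)) t))

  Accessible : Focus → Set
  Accessible f = ∀ j → f ≡ inp j → j < n

  accessible-aux : ∀ {w} → Accessible (aux w)
  accessible-aux j ()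

  accessible-out : Accessible out
  accessible-out j ()

  accessible-inp : ∀ {i} → i < n → Accessible (inp i)
  accessible-inp i<n j refl = i<n

  assignTrue : Focus → List Instruction
  assignTrue f = plain (f ∙ set true) ∷ []

  runs-true : ∀ {f s} → Accessible f → Runs (assignTrue f) s (setIf true f s)
  runs-true ok (e , _) t = do-plain e ok t

  runs-copy : ∀ {g f s} → Accessible g → Accessible f →
              Runs (+test (g ∙ get) ∷ assignTrue f) s (setIf (s g) f s)
  runs-copy {g} {f} {s} ok ok′ {i} {s′} (e , e′ , _) t = do-+test e ok (go (s g) t)
    where
    go : ∀ v → Ends (2 + i) (setIf v f s) s′ → Ends (if v then suc i else suc (suc i)) s s′
    go true  t = do-plain e′ ok′ t
    go false t = t

  runs-negate : ∀ {g f s} → Accessible g → Accessible f →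
                Runs (-test (g ∙ get) ∷ assignTrue f) s (setIf (not (s g)) f s)
  runs-negate {g} {f} {s} ok ok′ {i} {s′} (e , e′ , _) t = do--test e ok (go (s g) t)
    where
    go : ∀ v → Ends (2 + i) (setIf (not v) f s) s′ → Ends (if v then suc (suc i) else suc i) s s′
    go true  t = t
    go false t = do-plain e′ ok′ t

  -- If `g` holds `false`, the jump leaves the block; otherwise its second half copies `h`.
  runs-and : ∀ {g h f s} → Accessible g → Accessible h → Accessible f →
             Runs (-test (g ∙ get) ∷ jump 3 ∷ +test (h ∙ get) ∷ assignTrue f) s (setIf (s g ∧ s h) f s)
  runs-and {g} {h} {f} {s} ok-g ok-h ok {i} {s′} (e , e₁ , rest) t = do--test e ok-g (go (s g) t)
    where
    go : ∀ v → Ends (4 + i) (setIf (v ∧ s h) f s) s′ → Ends (if v then suc (suc i) else suc i) s s′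
    go true  t = runs-copy ok-h ok rest t
    go false t = do-jump e₁ t

  -- If `g` holds `true`, the jump lands on the final assignment, past the test of `h`.
  runs-or : ∀ {g h f s} → Accessible g → Accessible h → Accessible f →
            Runs (+test (g ∙ get) ∷ jump 2 ∷ +test (h ∙ get) ∷ assignTrue f) s (setIf (s g ∨ s h) f s)
  runs-or {g} {h} {f} {s} ok-g ok-h ok {i} {s′} (e , e₁ , rest@(_ , e₃ , _)) t = do-+test e ok-g (go (s g) t)
    where
    go : ∀ v → Ends (4 + i) (setIf (v ∨ s h) f s) s′ → Ends (if v then suc i else suc (suc i)) s s′
    go true  t = do-jump e₁ (do-plain e₃ ok t)
    go false t = runs-copy ok-h ok rest t

-- Wire j of w wires is kept in register aux (w ∸ 1 ∸ j), so that the
-- registers in use do not change when a gate is added.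

wireRegister : ∀ {w} → Fin w → Focus
wireRegister j = aux (toℕ (opposite j))

record Stores {n w} (b : Vec Bool n) (v : Vec Bool w) (s : Registers) : Set where
  constructor stores
  field
    inputs : ∀ i → s (inp (toℕ i)) ≡ Vec.lookup b i
    wires  : ∀ j → s (wireRegister j) ≡ Vec.lookup v j
    fresh  : ∀ {i} → w ≤ i → s (aux i) ≡ false
    output : s out ≡ false

open Stores

stores-setIf : ∀ {n w} {b : Vec Bool n} {v : Vec Bool w} {s} a → Stores b v s →
               Stores b (a ∷ v) (setIf a (aux w) s)
stores-setIf {w = w} {s = s} false h = stores (inputs h)
  (λ { zero    → trans (cong (λ i → s (aux i)) (toℕ-fromℕ w)) (fresh h ≤-refl)
     ; (suc j) → trans (cong (λ i → s (aux i)) (toℕ-inject₁ (opposite j))) (wires h j) })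
  (λ w<i → fresh h (<⇒≤ w<i)) (output h)
stores-setIf {w = w} {s = s} true h = stores (inputs h)
  (λ { zero    → cong (if_then true else s (aux (toℕ (fromℕ w)))) (dec-true (aux (toℕ (fromℕ w)) ≟ᶠ aux w) (cong aux (toℕ-fromℕ w)))
     ; (suc j) → trans (other (<⇒≢ (<-≤-trans (s≤s (≤-reflexive (toℕ-inject₁ (opposite j)))) (toℕ<n (opposite j)))))
                       (trans (cong (λ i → s (aux i)) (toℕ-inject₁ (opposite j))) (wires h j)) })
  (λ w<i → trans (other (≢-sym (<⇒≢ w<i))) (fresh h (<⇒≤ w<i))) (output h)
  where
  other : ∀ {i} → i ≢ w → (if does (aux i ≟ᶠ aux w) then true else s (aux i)) ≡ s (aux i)
  other {i} i≢w = cong (if_then true else s (aux i)) (dec-false (aux i ≟ᶠ aux w) λ { refl → i≢w refl })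

gateCode : ∀ {w} → Gate w → List Instruction
gateCode {w} (const true)  = plain (aux w ∙ set true) ∷ []
gateCode {w} (const false) = []
gateCode {w} (¬ᵍ i)        = -test (wireRegister i ∙ get) ∷ plain (aux w ∙ set true) ∷ []
gateCode {w} (i ∧ᵍ j)      =
  -test (wireRegister i ∙ get) ∷ jump 3 ∷ +test (wireRegister j ∙ get) ∷ plain (aux w ∙ set true) ∷ []
gateCode {w} (i ∨ᵍ j)      =
  +test (wireRegister i ∙ get) ∷ jump 2 ∷ +test (wireRegister j ∙ get) ∷ plain (aux w ∙ set true) ∷ []

choiceCode : ∀ {m} → ℕ → Choice m → List Instruction
choiceCode w (i , true  , true)  = plain (aux w ∙ set true) ∷ []
choiceCode w (i , true  , false) = +test (inp (toℕ i) ∙ get) ∷ plain (aux w ∙ set true) ∷ []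
choiceCode w (i , false , true)  = -test (inp (toℕ i) ∙ get) ∷ plain (aux w ∙ set true) ∷ []
choiceCode w (i , false , false) = []

gatesCode : ∀ {m s} → Gates m s → List Instruction
gatesCode []       = []
gatesCode (gs ▷ g) = gatesCode gs ++ gateCode g

-- The last bit is computed first, which lays out the circuit inputs like gate wires: the newest at
-- the head of the vector, in the register numbered by the count of earlier ones.
choicesCode : ∀ {m} → List (Choice m) → List Instruction
choicesCode []       = []
choicesCode (c ∷ cs) = choicesCode cs ++ choiceCode (length cs) c

circuitCode : ∀ {m} (cs : List (Choice m)) → Circuit (length cs) → InstructionSequence
-- `jump 1` does nothing; it supplies the head that `List⁺` asks for.
circuitCode cs D = jump 1 List⁺.∷ (choicesCode cs ++ gatesCode (Circuit.gates D)) ++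
  +test (wireRegister (Circuit.output D) ∙ get) ∷ plain (out ∙ set true) ∷ ! ∷ []

allowed-gate : ∀ {w} (g : Gate w) → All AllowedInstruction (gateCode g)
allowed-gate (const true)  = plain set-aux ∷ []
allowed-gate (const false) = []
allowed-gate (¬ᵍ i)        = -test get-aux ∷ plain set-aux ∷ []
allowed-gate (i ∧ᵍ j)      = -test get-aux ∷ jump ∷ +test get-aux ∷ plain set-aux ∷ []
allowed-gate (i ∨ᵍ j)      = +test get-aux ∷ jump ∷ +test get-aux ∷ plain set-aux ∷ []

allowed-choice : ∀ {m} w (c : Choice m) → All AllowedInstruction (choiceCode w c)
allowed-choice w (i , true  , true)  = plain set-aux ∷ []
allowed-choice w (i , true  , false) = +test get-inp ∷ plain set-aux ∷ []
allowed-choice w (i , false , true)  = -test get-inp ∷ plain set-aux ∷ []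
allowed-choice w (i , false , false) = []

allowed-gates : ∀ {m s} (gs : Gates m s) → All AllowedInstruction (gatesCode gs)
allowed-gates []       = []
allowed-gates (gs ▷ g) = ++⁺ (allowed-gates gs) (allowed-gate g)

allowed-choices : ∀ {m} (cs : List (Choice m)) → All AllowedInstruction (choicesCode cs)
allowed-choices []       = []
allowed-choices (c ∷ cs) = ++⁺ (allowed-choices cs) (allowed-choice (length cs) c)

allowed-circuit : ∀ {m} (cs : List (Choice m)) D → ISbr (circuitCode cs D)
allowed-circuit cs D = jump ∷ ++⁺ (++⁺ (allowed-choices cs) (allowed-gates (Circuit.gates D)))
  (+test get-aux ∷ plain set-out ∷ ! ∷ [])

length-gate : ∀ {w} (g : Gate w) → length (gateCode g) ≤ 4
length-gate (const true)  = s≤s z≤n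
length-gate (const false) = z≤n
length-gate (¬ᵍ i)        = s≤s (s≤s z≤n)
length-gate (i ∧ᵍ j)      = ≤-refl
length-gate (i ∨ᵍ j)      = ≤-refl

length-choice : ∀ {m} w (c : Choice m) → length (choiceCode w c) ≤ 4
length-choice w (i , true  , true)  = s≤s z≤n
length-choice w (i , true  , false) = s≤s (s≤s z≤n)
length-choice w (i , false , true)  = s≤s (s≤s z≤n)
length-choice w (i , false , false) = z≤n

length-snoc : ∀ k (P Q : List Instruction) → length P ≤ k * 4 → length Q ≤ 4 → length (P ++ Q) ≤ suc k * 4
length-snoc k P Q p q = ≤-trans (≤-reflexive (trans (length-++ P) (+-comm (length P) (length Q)))) (+-mono-≤ q p)

length-gates : ∀ {m s} (gs : Gates m s) → length (gatesCode gs) ≤ s * 4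
length-gates []       = z≤n
length-gates {s = suc k} (gs ▷ g) = length-snoc k (gatesCode gs) (gateCode g) (length-gates gs) (length-gate g)

length-choices : ∀ {m} (cs : List (Choice m)) → length (choicesCode cs) ≤ length cs * 4
length-choices []       = z≤n
length-choices (c ∷ cs) = length-snoc (length cs) (choicesCode cs) (choiceCode (length cs) c) (length-choices cs) (length-choice (length cs) c)

length-circuitCode : ∀ {m} (cs : List (Choice m)) D →
  List⁺.length (circuitCode cs D) ≤ suc ((length cs * 4 + Circuit.size D * 4) + 3)
length-circuitCode cs D = s≤s (begin
  length ((choicesCode cs ++ gatesCode gs) ++ _)             ≡⟨ length-++ (choicesCode cs ++ gatesCode gs) ⟩
  length (choicesCode cs ++ gatesCode gs) + 3                ≡⟨ cong (_+ 3) (length-++ (choicesCode cs)) ⟩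
  (length (choicesCode cs) + length (gatesCode gs)) + 3      ≤⟨ +-monoˡ-≤ 3 (+-mono-≤ (length-choices cs) (length-gates gs)) ⟩
  (length cs * 4 + Circuit.size D * 4) + 3                                ∎)
  where
  open ≤-Reasoning
  gs = Circuit.gates D

-- Correctness of the code of a circuit

module _ {n m : ℕ} (m≤n : m ≤ n) (b : Vec Bool n) where

  selection : Fin m → Bool
  selection i = Vec.lookup b (inject≤ i m≤n)

  chosen : (cs : List (Choice m)) → Vec Bool (length cs)
  chosen cs = Vec.map (choose selection) (fromList cs)

  module _ (X : InstructionSequence) where

    Computing : ∀ {w} → List Instruction → Registers → Vec Bool w → Set
    Computing P s v = ∃[ s₁ ] Runs X n P s s₁ × Stores b v s₁

    compute : ∀ {w P s} {v : Vec Bool w} {a a′} → Stores b v s → a′ ≡ a →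
              Runs X n P s (setIf a′ (aux w) s) → Computing P s (a ∷ v)
    compute {a = a} h refl r = _ , r , stores-setIf a h

    compute-gate : ∀ {w s} {v : Vec Bool w} (g : Gate w) → Stores b v s → Computing (gateCode g) s (gateValue g v ∷ v)
    compute-gate (const true)  h = compute h refl (runs-true X n (accessible-aux X n))
    compute-gate (const false) h = compute h refl (runs-[] X n)
    compute-gate (¬ᵍ i)        h = compute h (cong not (wires h i)) (runs-negate X n (accessible-aux X n) (accessible-aux X n))
    compute-gate (i ∧ᵍ j)      h = compute h (cong₂ _∧_ (wires h i) (wires h j))
      (runs-and X n (accessible-aux X n) (accessible-aux X n) (accessible-aux X n))
    compute-gate (i ∨ᵍ j)      h = compute h (cong₂ _∨_ (wires h i) (wires h j))
      (runs-or X n (accessible-aux X n) (accessible-aux X n) (accessible-aux X n))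

    input-value : ∀ {w s} {v : Vec Bool w} i → Stores b v s → s (inp (toℕ i)) ≡ selection i
    input-value {s = s} i h = trans (cong (λ j → s (inp j)) (sym (toℕ-inject≤ i m≤n))) (inputs h (inject≤ i m≤n))

    compute-choice : ∀ {w s} {v : Vec Bool w} c → Stores b v s → Computing (choiceCode w c) s (choose selection c ∷ v)
    compute-choice (i , true  , true)  h = compute h (sym (Bool.if-eta (selection i))) (runs-true X n (accessible-aux X n))
    compute-choice (i , true  , false) h = compute h (trans (input-value i h) (if-id (selection i)))
      (runs-copy X n (accessible-inp X n (<-≤-trans (toℕ<n i) m≤n)) (accessible-aux X n))
      where
      if-id : ∀ a → a ≡ (if a then true else false)
      if-id true  = refl
      if-id false = refl
    compute-choice (i , false , true)  h = compute h (trans (cong not (input-value i h)) (if-not (selection i)))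
      (runs-negate X n (accessible-inp X n (<-≤-trans (toℕ<n i) m≤n)) (accessible-aux X n))
      where
      if-not : ∀ a → not a ≡ (if a then false else true)
      if-not true  = refl
      if-not false = refl
    compute-choice (i , false , false) h = compute h (sym (Bool.if-eta (selection i))) (runs-[] X n)

    compute-++ : ∀ {w w′ P Q s} {v : Vec Bool w} {v′ : Vec Bool w′} → Computing P s v →
                 (∀ {s₁} → Stores b v s₁ → Computing Q s₁ v′) → Computing (P ++ Q) s v′
    compute-++ (s₁ , r , h) f = let (s₂ , r′ , h′) = f h in s₂ , runs-++ X n r r′ , h′

    compute-gates : ∀ {w k s} {v : Vec Bool w} (gs : Gates w k) → Stores b v s → Computing (gatesCode gs) s (wireValues gs v)
    compute-gates []       h = _ , runs-[] X n , h
    compute-gates (gs ▷ g) h = compute-++ (compute-gates gs h) (compute-gate g)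

    compute-choices : ∀ {s} (cs : List (Choice m)) → Stores b [] s → Computing (choicesCode cs) s (chosen cs)
    compute-choices []       h = _ , runs-[] X n , h
    compute-choices (c ∷ cs) h = compute-++ (compute-choices cs h) (compute-choice c)

  initially : Stores b [] (initialRegisters b)
  initially = stores (register-get b) (λ ()) (λ _ → refl) refl

  located-suffix : ∀ (X : InstructionSequence) P i → drop i (List⁺.toList X) ≡ P → Located X n i P
  located-suffix X []      i eq = tt
  located-suffix X (u ∷ P) i eq = cong List.head eq , located-suffix X P (suc i) (tail i (List⁺.toList X) eq)
    where
    tail : ∀ {A : Set} i (xs : List A) {y ys} → drop i xs ≡ y ∷ ys → drop (suc i) xs ≡ ys
    tail zero    (x ∷ xs) refl = refl
    tail (suc i) (x ∷ xs) eq   = tail i xs eq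

  circuitCode-correct : ∀ (cs : List (Choice m)) (D : Circuit (length cs)) → let X = circuitCode cs D in
    ∃[ s ] Terminates X (InputsBelow n) 0 (initialRegisters b) s × s out ≡ evaluate D (chosen cs)
  circuitCode-correct cs D =
    let (s₁ , r , h)  = compute-++ X (compute-choices X cs initially) (compute-gates X gs)
        (p , q)       = located-++ X n 1 body (located-suffix X (body ++ ending) 1 refl)
        (e , e′ , e″ , _) = q
        v             = s₁ (wireRegister (Circuit.output D))
    in setIf v out s₁ ,
       do-jump X n refl (r p (runs-copy X n (accessible-aux X n) (accessible-out X n) (e , e′ , tt) (at-! e″))) ,
       trans (final v (Stores.output h)) (wires h (Circuit.output D))
    where
    gs = Circuit.gates D
    X = circuitCode cs D
    body = choicesCode cs ++ gatesCode gs
    ending = +test (wireRegister (Circuit.output D) ∙ get) ∷ plain (out ∙ set true) ∷ ! ∷ []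
    final : ∀ {s} v → s out ≡ false → setIf v out s out ≡ v
    final true  eq = refl
    final false eq = eq

bool-ext : ∀ {a b} → (a ≡ true → b ≡ true) → (b ≡ true → a ≡ true) → a ≡ b
bool-ext {true}          f g = sym (f refl)
bool-ext {false} {true}  f g = g refl
bool-ext {false} {false} f g = refl

-- The circuit is the one for length `length (choices n)`, which is fixed by `n`. That length is
-- known only up to the bound `bits n`, and monotonicity of `⟦ h ⟧` carries the size bound over.
3SAT∈P/poly⇒3SATᶜ∈P*lis : (E : ClauseEnumeration) → P/poly 3SAT → P*lis (3SATᶜ E)
3SAT∈P/poly⇒3SATᶜ∈P*lis E (D , h , spec) = proj₁ bounded , λ n →
  code n , allowed-circuit (choices n) (D (length (choices n))) , computes n , ≤-trans (short n) (proj₂ bounded n)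
  where
  choices : ∀ n → List (Choice (d (level n)))
  choices n = Encoding.choices E n

  code : ∀ n → InstructionSequence
  code n = circuitCode (choices n) (D (length (choices n)))

  decides : ∀ n b → evaluate (D (length (choices n))) (Encoding.encoding E n b) ≡ 3SATᶜ E n b
  decides n b = bool-ext
    (λ eq → dec-true (satisfiable? (selected E n b)) (Encoding.encoding-sound E n b (to eq)))
    (λ eq → from (Encoding.encoding-complete E n b (does-sound (satisfiable? (selected E n b)) eq)))
    where open Equivalence (proj₂ (spec (length (choices n))) (Encoding.encoding E n b))

  computes : ∀ n → Computes (code n) (3SATᶜ E n)
  computes n b =
    let (s , t , eq) = circuitCode-correct (proj₁ (level-spec n)) b (choices n) (D (length (choices n)))
    in s , t , trans eq (decides n b)

  bits : ℕ → ℕ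
  bits n = n * (2 * (3 * n + 7))

  bound : ℕ → ℕ
  bound n = suc ((bits n * 4 + ⟦ h ⟧ (bits n) * 4) + 3)

  short : ∀ n → List⁺.length (code n) ≤ bound n
  short n = ≤-trans (length-circuitCode (choices n) (D (length (choices n))))
    (s≤s (+-monoˡ-≤ 3 (+-mono-≤ (*-monoˡ-≤ 4 (Encoding.length-choices E n))
      (*-monoˡ-≤ 4 (≤-trans (proj₁ (spec (length (choices n)))) (⟦⟧-mono h (Encoding.length-choices E n)))))))

  bounded-bits : Bounded bits
  bounded-bits = bounded-* bounded-id (bounded-* (bounded-const 2)
    (bounded-+ (bounded-* (bounded-const 3) bounded-id) (bounded-const 7)))

  bounded : Bounded bound
  bounded = bounded-suc (bounded-+ (bounded-+ (bounded-* bounded-bits (bounded-const 4))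
    (bounded-* (bounded-∘ h bounded-bits) (bounded-const 4))) (bounded-const 3))

theorem8 : (E : ClauseEnumeration) → (3SATᶜ E ∉ P*lis) ⇔ (3SAT ∉ P/poly)
theorem8 E = mk⇔
  (λ 3SATᶜ∉ 3SAT∈ → 3SATᶜ∉ (3SAT∈P/poly⇒3SATᶜ∈P*lis E 3SAT∈))
  (λ 3SAT∉ 3SATᶜ∈ → 3SAT∉ (3SATᶜ∈P*lis⇒3SAT∈P/poly E 3SATᶜ∈))
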